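{- Let $p$ be an odd prime and let $C$ and $D$ be self-orthogonal codes of length $k$ over $\mathbb{F}_p$. Then $L_A(C)\cong L_A(D)$ as lattices if and only if $C\cong D$ as codes.
   Context: A code of length $k$ over $\mathbb{F}_p$ is a subspace of $\mathbb{F}_p^k$, with the standard dot product $(x,y)=\sum_i x_iy_i$; $C^\perp$ is the dual code and $C$ is self-orthogonal if $C\subset C^\perp$. Two codes $C,D$ of length $k$ are isomorphic if $f(C)=D$ for some $f$ in the group generated by coordinate permutations and the maps $\sigma_i$ multiplying the $i$-th coordinate by $-1$. For $n\ge 2$, let $A_{n-1}=\{x\in\mathbb{Z}^n:\sum_i x_i=0\}$ with the standard inner product of $\mathbb{R}^n$, $e_1,\dots,e_n$ the standard basis, $\alpha_i=e_i-e_{i+1}$, and $\varepsilon_1=e_1-\frac1n(e_1+\cdots+e_n)$; the dual lattice $A_{n-1}^*$ satisfies $A_{n-1}^*/A_{n-1}=\langle \varepsilon_1+A_{n-1}\rangle\cong\mathbb{Z}/n$. For a prime $p$ identify $\mathbb{F}_p^k$ with $(A_{p-1}^*/A_{p-1})^k$ via $(a_1,\dots,a_k)\mapsto(a_1\varepsilon_1+A_{p-1},\dots,a_k\varepsilon_1+A_{p-1})$, and let $\pi:(A_{p-1}^*)^k\to(A_{p-1}^*/A_{p-1})^k$ be the quotient map. Construction A: $L_A(C)=\pi^{ -1}(C)\subset\mathbb{R}^{pk}$, a lattice with the standard inner product. Lattices are isomorphic if there is an inner-product-preserving group isomorphism between them. -}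

module Defs where

open import Data.Nat as ℕ using (ℕ; NonZero; _≡ᵇ_)
open import Data.Nat.DivMod using (_mod_)
open import Data.Fin using (Fin; toℕ)
open import Data.Fin.Permutation using (Permutation′; _⟨$⟩ʳ_)
open import Data.Vec using (Vec; lookup; tabulate; zipWith; foldr′; map)
open import Data.Integer as ℤ using (ℤ)
open import Data.Rational as ℚ using (ℚ; _/_; 0ℚ; 1ℚ)
open import Data.Bool using (Bool; if_then_else_)
open import Data.Product using (Σ; _×_)
open import Relation.Binary.PropositionalEquality using (_≡_)

module _ (p : ℕ) {{_ : NonZero p}} where

  _+F_ : Fin p → Fin p → Fin p
  a +F b = (toℕ a ℕ.+ toℕ b) mod p

  _*F_ : Fin p → Fin p → Fin p
  a *F b = (toℕ a ℕ.* toℕ b) mod p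

  0F : Fin p
  0F = 0 mod p

  -F_ : Fin p → Fin p
  -F a = (p ℕ.∸ toℕ a) mod p

  dot : ∀ {k} → Vec (Fin p) k → Vec (Fin p) k → Fin p
  dot x y = foldr′ _+F_ 0F (zipWith _*F_ x y)

  record IsSubspace {k : ℕ} (C : Vec (Fin p) k → Set) : Set where
    field
      zero-mem : C (tabulate (λ _ → 0F))
      add-mem  : ∀ x y → C x → C y → C (zipWith _+F_ x y)
      smul-mem : ∀ (c : Fin p) x → C x → C (map (c *F_) x)

  Dual : ∀ {k} → (Vec (Fin p) k → Set) → Vec (Fin p) k → Set
  Dual C y = ∀ x → C x → dot x y ≡ 0F

  SelfOrthogonal : ∀ {k} → (Vec (Fin p) k → Set) → Set
  SelfOrthogonal C = ∀ x → C x → Dual C x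

  -- element of the group generated by coordinate permutations and the
  -- sign changes σ_i: a signed permutation (s i = true means multiply by -1)
  signedPerm : ∀ {k} → Permutation′ k → Vec Bool k → Vec (Fin p) k → Vec (Fin p) k
  signedPerm π s x =
    tabulate (λ i → if lookup s i then -F (lookup x (π ⟨$⟩ʳ i)) else lookup x (π ⟨$⟩ʳ i))

  CodeIso : ∀ {k} → (Vec (Fin p) k → Set) → (Vec (Fin p) k → Set) → Set
  CodeIso {k} C D = Σ (Permutation′ k) λ π → Σ (Vec Bool k) λ s →
    (∀ x → C x → D (signedPerm π s x)) ×
    (∀ y → D y → Σ (Vec (Fin p) k) λ x → C x × signedPerm π s x ≡ y)

  -- Lattices in R^{pk}; all points involved have rational coordinates.
  -- A point of R^{pk} = (R^p)^k is a k-vector of p-vectors.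

  sumQ : ∀ {n} → Vec ℚ n → ℚ
  sumQ = foldr′ ℚ._+_ 0ℚ

  IsInt : ℚ → Set
  IsInt q = Σ ℤ λ z → q ≡ z / 1

  InA : Vec ℚ p → Set
  InA v = (∀ j → IsInt (lookup v j)) × (sumQ v ≡ 0ℚ)

  ε₁ : Vec ℚ p
  ε₁ = tabulate (λ j → (if toℕ j ≡ᵇ 0 then 1ℚ else 0ℚ) ℚ.- (ℤ.+ 1 / p))

  toQ : Fin p → ℚ
  toQ a = ℤ.+ (toℕ a) / 1

  Amb : ℕ → Set
  Amb k = Vec (Vec ℚ p) k

  -- Construction A: x ∈ L_A(C) iff x ∈ (A_{p-1}^*)^k and π(x) ∈ C, i.e.
  -- there is a ∈ C with x_i - a_i ε₁ ∈ A_{p-1} for every block i.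
  LA : ∀ {k} → (Vec (Fin p) k → Set) → Amb k → Set
  LA {k} C x = Σ (Vec (Fin p) k) λ a → C a ×
    (∀ i → InA (zipWith ℚ._-_ (lookup x i) (map (toQ (lookup a i) ℚ.*_) ε₁)))

  addAmb : ∀ {k} → Amb k → Amb k → Amb k
  addAmb = zipWith (zipWith ℚ._+_)

  inner : ∀ {k} → Amb k → Amb k → ℚ
  inner x y = sumQ (zipWith (λ u v → sumQ (zipWith ℚ._*_ u v)) x y)

  LatticeIso : ∀ {k} → (Amb k → Set) → (Amb k → Set) → Set
  LatticeIso {k} P Q = Σ (Amb k → Amb k) λ f → Σ (Amb k → Amb k) λ g →
    (∀ x → P x → Q (f x)) × (∀ y → Q y → P (g y)) ×
    (∀ x → P x → g (f x) ≡ x) × (∀ y → Q y → f (g y) ≡ y) ×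
    (∀ x y → P x → P y → f (addAmb x y) ≡ addAmb (f x) (f y)) ×
    (∀ x y → P x → P y → inner (f x) (f y) ≡ inner x y)

{-# OPTIONS --safe #-}
module Submission where

-- A point of (A*_{p-1})^k is written as an integer array z, standing for the vector with
-- coordinates z_ix - (Σ_x z_ix)/p; it lies in L_A(C) iff the block sums of z, mod p, form a
-- word of C, and arrays differing by a constant on each block stand for the same vector.
-- Self-orthogonality makes L_A(D) integral, so reflections in its norm 2 vectors ("roots")
-- are automorphisms.  Let f : L_A(C) → L_A(D) be an isometry.  For p = 3 and p = 5, f need not
-- map A_{p-1}^k to A_{p-1}^k (A_2^3 ⊂ E_6, A_2^4 ⊂ E_8, A_4^2 ⊂ E_8), but f can be corrected by
-- reflections until it does: block by block, and inside a block one root e_0 - e_t after the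
-- other, the root u = f(e_0 - e_t) is moved to a root τ = ±(e_a - e_l) of a fixed block, with l
-- not used before.  If (u, τ) = 2 then u = τ, and if (u, τ) = 1 the reflection in u - τ maps u
-- to τ and fixes all roots treated earlier.  If (u, τ) ≤ 0, then for t = 2 the roles of the two
-- ends of the first root are exchanged, and for t > 2 a norm estimate forces p = 5 and
-- determines u completely; a reflection in an explicit root then leads back to (u, τ) = 1.
-- Once f maps every block A_{p-1} onto a block, it acts on A*/A by a signed permutation.

open import Defs
open import Algebra.Bundles using (CommutativeRing)
open import Data.Bool using (Bool; true; false; if_then_else_)
open import Data.Empty using (⊥; ⊥-elim)
open import Data.Fin using (Fin; zero; suc; toℕ; fromℕ<; punchOut; inject≤)
open import Data.Fin.Permutation using (Permutation′; permutation; _⟨$⟩ʳ_; _⟨$⟩ˡ_; inverseˡ; inverseʳ)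
import Data.Fin.Properties as Fin
open import Data.Integer using (ℤ; +_; -[1+_]; _+_; _*_; _-_; -_; _≤_; _<_; 0ℤ; 1ℤ; -1ℤ; +≤+; +<+)
import Data.Integer as ℤ using (∣_∣)
open import Data.Integer.DivMod using (_%ℕ_; _/ℕ_; a≡a%ℕn+[a/ℕn]*n)
import Data.Integer.Divisibility.Signed as ℤ using (∣ᵤ⇒∣; divides)
open import Data.Integer.Properties hiding (_≟_)
import Data.Integer.Properties as ℤ using (_≟_)
open import Data.Integer.Tactic.RingSolver using (solve-∀)
open import Data.Nat as ℕ using (ℕ; zero; suc; NonZero; _≡ᵇ_)
open import Data.Nat.DivMod using (_mod_; _/_; m≡m%n+[m/n]*n; m%n<n)
open import Data.Nat.Divisibility using (_∣_)
import Data.Nat.Divisibility as ℕ using (divides)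
open import Data.Nat.Primality using (Prime; euclidsLemma; prime⇒nonZero; prime⇒nonTrivial; ¬prime[0])
import Data.Nat.Properties as ℕ
open import Data.Product using (Σ; ∃; _×_; _,_; proj₁; proj₂)
import Data.Rational as ℚ
open ℚ using (ℚ; 0ℚ; 1ℚ)
import Data.Rational.Properties as ℚ
open import Data.Rational.Solver using (module +-*-Solver)
import Data.Rational.Unnormalised as ℚᵘ
open ℚᵘ using (mkℚᵘ; *≡*)
import Data.Rational.Unnormalised.Properties as ℚᵘ
open import Data.Sum as Sum using (_⊎_; inj₁; inj₂)
open import Data.Vec using (Vec; []; _∷_; lookup; tabulate; zipWith; map)
open import Data.Vec.Properties using (lookup-zipWith; lookup-map; lookup∘tabulate; tabulate∘lookup; tabulate-cong)
open import Function using (_∘_)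
open import Function.Bundles using (_⇔_; mk⇔)
open import Relation.Binary.PropositionalEquality
open import Relation.Nullary using (¬_; Dec; yes; no; contradiction; does; ¬?)
open import Relation.Nullary.Decidable using (_×-dec_; dec-true; dec-false)
open import Algebra.Properties.Semiring.Sum +-*-semiring using (sum; sum-cong-≗; ∑-distrib-+; sum-permute; *-distribˡ-sum)
import Algebra.Properties.Semiring.Sum (CommutativeRing.semiring ℚ.+-*-commutativeRing) as Σℚ

-- An array is determined by its products under `B` only up to the radical, the arrays constant on
-- each block. Images are therefore compared by pairing them with arbitrary arrays, and a vector is
-- shown to be zero by showing that its norm is. Why the bad case is confined to p = 5: for t > 2,
-- (u, τ) ≤ 0 makes two entries of u (at `σ zero` and `l`, up to the sign `s`) exceed two equal ones
-- (at `σ one` and `σ two`). Rounding to 0/1 arrays shows that this block costs norm at least 2(p -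
-- 2)/p, and any other block on which u is not constant at least (p - 1)/p. The budget 2 gives 3p -
-- 5 ≤ 2p, while four distinct indices give p ≥ 4. A root inside a single block is excluded
-- separately, being a difference of two basis vectors. At p = 5 the budget is spent exactly, 6/5 +
-- 4/5 = 2, so every estimate is an equality and u is known. For p = 3 a block has only t = 1, 2,
-- and exchanging the ends suffices.

≤-by : ∀ {x y} e → 0ℤ ≤ e → y ≡ x + e → x ≤ y
≤-by {x} e 0≤e refl = subst (_≤ x + e) (+-identityʳ x) (+-monoʳ-≤ x 0≤e)

0≤+ : ∀ {x y} → 0ℤ ≤ x → 0ℤ ≤ y → 0ℤ ≤ x + y
0≤+ = +-mono-≤

0≤* : ∀ {x y} → 0ℤ ≤ x → 0ℤ ≤ y → 0ℤ ≤ x * y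
0≤* {+ m} {+ n} _ _ = subst (0ℤ ≤_) (pos-* m n) (+≤+ ℕ.z≤n)

0≤-diff : ∀ {x y} → x ≤ y → 0ℤ ≤ y - x
0≤-diff = i≤j⇒0≤j-i

sq : ℤ → ℤ
sq x = x * x

0≤sq : ∀ x → 0ℤ ≤ sq x
0≤sq (+ n) = 0≤* (+≤+ (ℕ.z≤n {n})) (+≤+ ℕ.z≤n)
0≤sq -[1+ n ] = +≤+ ℕ.z≤n

sq-mono : ∀ {x y} → 0ℤ ≤ x → x ≤ y → sq x ≤ sq y
sq-mono {x} {y} 0≤x x≤y = ≤-by ((y - x) * (y + x))
  (0≤* (0≤-diff x≤y) (0≤+ (≤-trans 0≤x x≤y) 0≤x)) (eq x y)
  where
  eq : ∀ x y → y * y ≡ x * x + (y - x) * (y + x)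
  eq = solve-∀

sq≡0⇒≡0 : ∀ x → sq x ≡ 0ℤ → x ≡ 0ℤ
sq≡0⇒≡0 x e with i*j≡0⇒i≡0∨j≡0 x e
... | inj₁ r = r
... | inj₂ r = r

-- Finite sums of integers and lower bounds by single terms.

δ : ∀ {n} → Fin n → Fin n → ℤ
δ a b = if does (a Fin.≟ b) then 1ℤ else 0ℤ

δ-refl : ∀ {n} (a : Fin n) → δ a a ≡ 1ℤ
δ-refl a with a Fin.≟ a
... | yes _ = refl
... | no ¬p = contradiction refl ¬p

δ-≢ : ∀ {n} {a b : Fin n} → a ≢ b → δ a b ≡ 0ℤ
δ-≢ {a = a} {b} a≢b with a Fin.≟ b
... | yes p = contradiction p a≢b
... | no _ = refl

sum-zero : ∀ {n} {f : Fin n → ℤ} → (∀ x → f x ≡ 0ℤ) → sum f ≡ 0ℤ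
sum-zero {zero} h = refl
sum-zero {suc n} h rewrite h zero = trans (+-identityˡ _) (sum-zero (h ∘ suc))

sum-δ : ∀ {n} (a : Fin n) (f : Fin n → ℤ) → sum (λ x → δ a x * f x) ≡ f a
sum-δ zero f = trans (cong₂ _+_ (*-identityˡ (f zero)) (sum-zero {f = λ x → 0ℤ * f (suc x)} (λ x → *-zeroˡ (f (suc x))))) (+-identityʳ _)
sum-δ (suc a) f = trans (cong₂ _+_ (*-zeroˡ (f zero)) (sum-δ a (f ∘ suc))) (+-identityˡ _)

sum-scale : ∀ {n} c (f : Fin n → ℤ) → sum (λ x → c * f x) ≡ c * sum f
sum-scale c f = sym (*-distribˡ-sum c f)

sum-lin : ∀ {n} c (f g : Fin n → ℤ) → sum (λ x → f x + c * g x) ≡ sum f + c * sum g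
sum-lin c f g = trans (∑-distrib-+ f (λ x → c * g x)) (cong (_+_ (sum f)) (sum-scale c g))

sum-const : ∀ n c → sum {n} (λ _ → c) ≡ + n * c
sum-const zero c = sym (*-zeroˡ c)
sum-const (suc n) c = trans (cong (_+_ c) (sum-const n c)) (sym (suc-* (+ n) c))

sum-mono : ∀ {n} {f g : Fin n → ℤ} → (∀ x → f x ≤ g x) → sum f ≤ sum g
sum-mono {zero} h = ≤-refl
sum-mono {suc n} h = +-mono-≤ (h zero) (sum-mono (h ∘ suc))

sum-nonneg : ∀ {n} {f : Fin n → ℤ} → (∀ x → 0ℤ ≤ f x) → 0ℤ ≤ sum f
sum-nonneg {zero} h = ≤-refl
sum-nonneg {suc n} h = 0≤+ (h zero) (sum-nonneg (h ∘ suc))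

-- Clears one entry without shrinking the index set, so the bounds by two and three terms follow by
-- iterating the bound by one term.
mask : ∀ {n} → Fin n → (Fin n → ℤ) → Fin n → ℤ
mask a f x = f x + -1ℤ * (δ a x * f x)

mask-≢ : ∀ {n} {a x : Fin n} (f : Fin n → ℤ) → a ≢ x → mask a f x ≡ f x
mask-≢ {x = x} f a≢x rewrite δ-≢ a≢x = eq (f x)
  where
  eq : ∀ y → y + -1ℤ * (0ℤ * y) ≡ y
  eq = solve-∀

mask-nonneg : ∀ {n} (a : Fin n) {f : Fin n → ℤ} → (∀ x → 0ℤ ≤ f x) → ∀ x → 0ℤ ≤ mask a f x
mask-nonneg a {f} h x with a Fin.≟ x
... | yes _ = ≤-reflexive (sym (eq (f x)))
  where
  eq : ∀ y → y + -1ℤ * (1ℤ * y) ≡ 0ℤ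
  eq = solve-∀
... | no _ = subst (0ℤ ≤_) (sym (eq (f x))) (h x)
  where
  eq : ∀ y → y + -1ℤ * (0ℤ * y) ≡ y
  eq = solve-∀

sum-mask : ∀ {n} (a : Fin n) (f : Fin n → ℤ) → sum f ≡ f a + sum (mask a f)
sum-mask a f = begin
  sum f                       ≡⟨ eq (sum f) (f a) ⟩
  f a + (sum f + -1ℤ * f a)   ≡⟨ cong (λ y → f a + (sum f + -1ℤ * y)) (sym (sum-δ a f)) ⟩
  f a + (sum f + -1ℤ * sum (λ x → δ a x * f x)) ≡⟨ cong (_+_ (f a)) (sym (sum-lin -1ℤ f (λ x → δ a x * f x))) ⟩
  f a + sum (mask a f) ∎
  where
  open ≡-Reasoning
  eq : ∀ s y → s ≡ y + (s + -1ℤ * y)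
  eq = solve-∀

one-term : ∀ {n} (a : Fin n) {f : Fin n → ℤ} → (∀ x → 0ℤ ≤ f x) → f a ≤ sum f
one-term a {f} h = ≤-by _ (sum-nonneg (mask-nonneg a h)) (sum-mask a f)

two-terms : ∀ {n} {a b : Fin n} {f : Fin n → ℤ} → a ≢ b → (∀ x → 0ℤ ≤ f x) → f a + f b ≤ sum f
two-terms {a = a} {b} {f} a≢b h = subst₂ (λ y s → f a + y ≤ s) (mask-≢ f a≢b) (sym (sum-mask a f))
  (+-monoʳ-≤ (f a) (one-term b (mask-nonneg a h)))

three-terms : ∀ {n} {a b c : Fin n} {f : Fin n → ℤ} → a ≢ b → a ≢ c → b ≢ c → (∀ x → 0ℤ ≤ f x) → f a + (f b + f c) ≤ sum f
three-terms {a = a} {b} {c} {f} a≢b a≢c b≢c h =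
  subst₂ (λ y s → f a + y ≤ s) (cong₂ _+_ (mask-≢ f a≢b) (mask-≢ f a≢c)) (sym (sum-mask a f))
    (+-monoʳ-≤ (f a) (two-terms b≢c (mask-nonneg a h)))

sum-≤0⇒≡0 : ∀ {n} {f : Fin n → ℤ} → (∀ x → 0ℤ ≤ f x) → sum f ≤ 0ℤ → ∀ x → f x ≡ 0ℤ
sum-≤0⇒≡0 h s x = ≤-antisym (≤-trans (one-term x h) s) (h x)

sum-tight : ∀ {n} {f g : Fin n → ℤ} → (∀ x → f x ≤ g x) → sum g ≤ sum f → ∀ x → f x ≡ g x
sum-tight {f = f} {g} h s x = sym (i-j≡0⇒i≡j (g x) (f x)
  (trans (sym (eq (g x) (f x))) (sum-≤0⇒≡0 {f = λ x → g x + -1ℤ * f x} (λ y → subst (0ℤ ≤_) (sym (eq (g y) (f y))) (0≤-diff (h y)))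
    (subst (_≤ 0ℤ) (sym (trans (sum-lin -1ℤ g f) (eq (sum g) (sum f)))) (i≤j⇒i-j≤0 s)) x)))
  where
  eq : ∀ a b → a + -1ℤ * b ≡ a - b
  eq = solve-∀

-- The scaled inner product on one block.

opaque

  -- n times the inner product of the projections of u and v to the hyperplane of sum 0.
  blk : ∀ {n} → (Fin n → ℤ) → (Fin n → ℤ) → ℤ
  blk {n} u v = + n * sum (λ x → u x * v x) - sum u * sum v

  blk-comm : ∀ {n} (u v : Fin n → ℤ) → blk u v ≡ blk v u
  blk-comm {n} u v = cong₂ (λ a b → + n * a - b) (sum-cong-≗ (λ x → *-comm (u x) (v x))) (*-comm (sum u) (sum v))

  blk-cong : ∀ {n} {u u′ v v′ : Fin n → ℤ} → (∀ x → u x ≡ u′ x) → (∀ x → v x ≡ v′ x) → blk u v ≡ blk u′ v′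
  blk-cong {n} e f = cong₂ (λ a b → + n * a - b) (sum-cong-≗ (λ x → cong₂ _*_ (e x) (f x))) (cong₂ _*_ (sum-cong-≗ e) (sum-cong-≗ f))

  blk-lin : ∀ {n} c (u v w : Fin n → ℤ) → blk (λ x → u x + c * v x) w ≡ blk u w + c * blk v w
  blk-lin {n} c u v w = begin
    + n * sum (λ x → (u x + c * v x) * w x) - sum (λ x → u x + c * v x) * sum w
      ≡⟨ cong₂ (λ a b → + n * a - b * sum w)
           (trans (sum-cong-≗ (λ x → eq₁ (u x) c (v x) (w x))) (sum-lin c (λ x → u x * w x) (λ x → v x * w x)))
           (sum-lin c u v) ⟩
    + n * (sum (λ x → u x * w x) + c * sum (λ x → v x * w x)) - (sum u + c * sum v) * sum w
      ≡⟨ eq₂ (+ n) (sum (λ x → u x * w x)) c (sum (λ x → v x * w x)) (sum u) (sum v) (sum w) ⟩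
    blk u w + c * blk v w ∎
    where
    open ≡-Reasoning
    eq₁ : ∀ u c v w → (u + c * v) * w ≡ u * w + c * (v * w)
    eq₁ = solve-∀
    eq₂ : ∀ n a c b s t r → n * (a + c * b) - (s + c * t) * r ≡ (n * a - s * r) + c * (n * b - t * r)
    eq₂ = solve-∀

  blk-scale : ∀ {n} c (v w : Fin n → ℤ) → blk (λ x → c * v x) w ≡ c * blk v w
  blk-scale {n} c v w = begin
    + n * sum (λ x → (c * v x) * w x) - sum (λ x → c * v x) * sum w
      ≡⟨ cong₂ (λ a b → + n * a - b * sum w)
          (trans (sum-cong-≗ (λ x → *-assoc c (v x) (w x))) (sum-scale c (λ x → v x * w x))) (sum-scale c v) ⟩
    + n * (c * sum (λ x → v x * w x)) - (c * sum v) * sum w ≡⟨ eq (+ n) c (sum (λ x → v x * w x)) (sum v) (sum w) ⟩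
    c * blk v w ∎
    where
    open ≡-Reasoning
    eq : ∀ n c a s t → n * (c * a) - (c * s) * t ≡ c * (n * a - s * t)
    eq = solve-∀

  blk-const : ∀ {n} c {u : Fin n → ℤ} (v : Fin n → ℤ) → (∀ x → u x ≡ c) → blk u v ≡ 0ℤ
  blk-const {n} c {u} v h = begin
    + n * sum (λ x → u x * v x) - sum u * sum v
      ≡⟨ cong₂ (λ a b → + n * a - b * sum v) (trans (sum-cong-≗ (λ x → cong (_* v x) (h x))) (sum-scale c v))
           (trans (sum-cong-≗ h) (sum-const n c)) ⟩
    + n * (c * sum v) - (+ n * c) * sum v ≡⟨ eq (+ n) c (sum v) ⟩
    0ℤ ∎
    where
    open ≡-Reasoning
    eq : ∀ n c s → n * (c * s) - (n * c) * s ≡ 0ℤ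
    eq = solve-∀

  sum-δ₁ : ∀ {n} (a : Fin n) → sum (δ a) ≡ 1ℤ
  sum-δ₁ a = trans (sum-cong-≗ (λ x → sym (*-identityʳ (δ a x)))) (sum-δ a (λ _ → 1ℤ))

  blk-δ : ∀ {n} (a : Fin n) (v : Fin n → ℤ) → blk (δ a) v ≡ + n * v a - sum v
  blk-δ {n} a v = cong₂ (λ y s → + n * y - s) (sum-δ a v) (trans (cong (_* sum v) (sum-δ₁ a)) (*-identityˡ (sum v)))

  -- The variance as a sum over pairs. Positivity, comparison and the equality case of `blk` thereby
  -- reduce to differences of entries, which ignore a constant added to the block.
  blk-double : ∀ {n} (u : Fin n → ℤ) → sum (λ a → sum (λ b → sq (u a - u b))) ≡ blk u u + blk u u
  blk-double {n} u = begin
    sum (λ a → sum (λ b → sq (u a - u b)))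
      ≡⟨ sum-cong-≗ (λ a → trans (sum-cong-≗ (λ b → eq₁ (u a) (u b)))
           (trans (sum-lin (-[1+ 1 ] * u a) (λ b → sq (u a) + u b * u b) u)
             (cong (_+ (-[1+ 1 ] * u a) * S) (trans (∑-distrib-+ (λ _ → sq (u a)) (λ b → u b * u b)) (cong (_+ T) (sum-const n (sq (u a)))))))) ⟩
    sum (λ a → (+ n * sq (u a) + T) + (-[1+ 1 ] * u a) * S)
      ≡⟨ sum-cong-≗ (λ a → eq₂ (+ n * sq (u a)) T (u a) S) ⟩
    sum (λ a → (+ n * sq (u a) + T) + (-[1+ 1 ] * S) * u a)
      ≡⟨ sum-lin (-[1+ 1 ] * S) (λ a → + n * sq (u a) + T) u ⟩
    sum (λ a → + n * sq (u a) + T) + (-[1+ 1 ] * S) * S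
      ≡⟨ cong (_+ (-[1+ 1 ] * S) * S) (trans (∑-distrib-+ (λ a → + n * sq (u a)) (λ _ → T)) (cong₂ _+_ (sum-scale (+ n) (λ a → sq (u a))) (sum-const n T))) ⟩
    (+ n * T + + n * T) + (-[1+ 1 ] * S) * S ≡⟨ eq₃ (+ n * T) S ⟩
    blk u u + blk u u ∎
    where
    open ≡-Reasoning
    S T : ℤ
    S = sum u
    T = sum (λ x → u x * u x)
    eq₁ : ∀ a b → (a - b) * (a - b) ≡ (a * a + b * b) + (-[1+ 1 ] * a) * b
    eq₁ = solve-∀
    eq₂ : ∀ a t u s → (a + t) + (-[1+ 1 ] * u) * s ≡ (a + t) + (-[1+ 1 ] * s) * u
    eq₂ = solve-∀
    eq₃ : ∀ a s → (a + a) + (-[1+ 1 ] * s) * s ≡ (a - s * s) + (a - s * s)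
    eq₃ = solve-∀

half-≤ : ∀ {x y} → x + x ≤ y + y → x ≤ y
half-≤ {x} {y} h with x ≤? y
... | yes p = p
... | no ¬p = contradiction h (<⇒≱ (+-mono-< (≰⇒> ¬p) (≰⇒> ¬p)))

blk-nonneg : ∀ {n} (u : Fin n → ℤ) → 0ℤ ≤ blk u u
blk-nonneg u = half-≤ (subst (0ℤ ≤_) (blk-double u) (sum-nonneg (λ a → sum-nonneg (λ b → 0≤sq (u a - u b)))))

blk-mono : ∀ {n} {u v : Fin n → ℤ} → (∀ a b → sq (u a - u b) ≤ sq (v a - v b)) → blk u u ≤ blk v v
blk-mono {u = u} {v} h = half-≤ (subst₂ _≤_ (blk-double u) (blk-double v) (sum-mono (λ a → sum-mono (h a))))

blk-tight : ∀ {n} {u v : Fin n → ℤ} → (∀ a b → sq (u a - u b) ≤ sq (v a - v b)) → blk v v ≤ blk u u →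
  ∀ a b → sq (u a - u b) ≡ sq (v a - v b)
blk-tight {u = u} {v} h le a = sum-tight (h a) (≤-reflexive (sym
  (sum-tight (λ a → sum-mono (h a)) (subst₂ _≤_ (sym (blk-double v)) (sym (blk-double u)) (+-mono-≤ le le)) a)))

blk≤0⇒const : ∀ {n} {u : Fin n → ℤ} → blk u u ≤ 0ℤ → ∀ a b → u a ≡ u b
blk≤0⇒const {n} {u} le a b = i-j≡0⇒i≡j (u a) (u b) (sq≡0⇒≡0 _ (sym
  (blk-tight {u = λ _ → 0ℤ} {v = u} (λ a b → 0≤sq (u a - u b)) (subst (blk u u ≤_) (sym (blk-const {n} 0ℤ (λ _ → 0ℤ) (λ _ → refl))) le) a b)))

-- Rounding integer arrays to indicators of superlevel sets.

up : ∀ {n} → ℤ → (Fin n → ℤ) → Fin n → ℤ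
up θ u x = if does (θ <? u x) then 1ℤ else 0ℤ

up-cases : ∀ {n} θ (u : Fin n → ℤ) x → (θ < u x × up θ u x ≡ 1ℤ) ⊎ (u x ≤ θ × up θ u x ≡ 0ℤ)
up-cases θ u x with θ <? u x
... | yes p = inj₁ (p , refl)
... | no ¬p = inj₂ (≮⇒≥ ¬p , refl)

up-high : ∀ {n θ} (u : Fin n → ℤ) {x} → θ < u x → up θ u x ≡ 1ℤ
up-high {θ = θ} u {x} h with up-cases θ u x
... | inj₁ (_ , e) = e
... | inj₂ (le , _) = contradiction h (≤⇒≯ le)

up-low : ∀ {n θ} (u : Fin n → ℤ) {x} → u x ≤ θ → up θ u x ≡ 0ℤ
up-low {θ = θ} u {x} h with up-cases θ u x
... | inj₁ (lt , _) = contradiction lt (≤⇒≯ h)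
... | inj₂ (_ , e) = e

ZeroOne : ∀ {n} → (Fin n → ℤ) → Set
ZeroOne f = ∀ x → f x ≡ 0ℤ ⊎ f x ≡ 1ℤ

up-01 : ∀ {n} θ (u : Fin n → ℤ) → ZeroOne (up θ u)
up-01 θ u x with up-cases θ u x
... | inj₁ (_ , e) = inj₂ e
... | inj₂ (_ , e) = inj₁ e

01-nonneg : ∀ {n} {f : Fin n → ℤ} → ZeroOne f → ∀ x → 0ℤ ≤ f x
01-nonneg h x with h x
... | inj₁ e = ≤-reflexive (sym e)
... | inj₂ e = subst (0ℤ ≤_) (sym e) (+≤+ ℕ.z≤n)

01-compl : ∀ {n} {f : Fin n → ℤ} → ZeroOne f → ZeroOne (λ x → 1ℤ + -1ℤ * f x)
01-compl h x with h x
... | inj₁ e rewrite e = inj₂ refl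
... | inj₂ e rewrite e = inj₁ refl

sum-compl : ∀ {n} (f : Fin n → ℤ) → sum (λ x → 1ℤ + -1ℤ * f x) ≡ + n - sum f
sum-compl {n} f = trans (sum-lin -1ℤ (λ _ → 1ℤ) f) (trans (cong (_+ -1ℤ * sum f) (sum-const n 1ℤ)) (eq (+ n) (sum f)))
  where
  eq : ∀ n s → n * 1ℤ + -1ℤ * s ≡ n - s
  eq = solve-∀

opaque
  unfolding blk

  blk-01 : ∀ {n} {f : Fin n → ℤ} → ZeroOne f → blk f f ≡ sum f * (+ n - sum f)
  blk-01 {n} {f} h = trans (cong (λ y → + n * y - sum f * sum f) (sum-cong-≗ idem)) (eq (+ n) (sum f))
    where
    idem : ∀ x → f x * f x ≡ f x
    idem x with h x
    ... | inj₁ e rewrite e = refl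
    ... | inj₂ e rewrite e = refl
    eq : ∀ n s → n * s - s * s ≡ s * (n - s)
    eq = solve-∀

1≤-diff : ∀ {x y} → x < y → 1ℤ ≤ y - x
1≤-diff {x} {y} h = subst (_≤ y - x) (eq x) (+-monoˡ-≤ (- x) (i<j⇒suc[i]≤j h))
  where
  eq : ∀ x → (1ℤ + x) - x ≡ 1ℤ
  eq = solve-∀

-- Integers on opposite sides of the threshold differ by at least 1. So rounding never increases the
-- norm, and the norm of a 0/1 array depends only on its number t of ones: `blk-01` gives t(n - t).
up-sq : ∀ {n} θ (u : Fin n → ℤ) a b → sq (up θ u a - up θ u b) ≤ sq (u a - u b)
up-sq θ u a b with up-cases θ u a | up-cases θ u b
... | inj₁ (_ , e) | inj₁ (_ , f) rewrite e | f = 0≤sq (u a - u b)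
... | inj₂ (_ , e) | inj₂ (_ , f) rewrite e | f = 0≤sq (u a - u b)
... | inj₁ (lt , e) | inj₂ (le , f) rewrite e | f = sq-mono (+≤+ ℕ.z≤n) (1≤-diff (≤-<-trans le lt))
... | inj₂ (le , e) | inj₁ (lt , f) rewrite e | f =
  subst (1ℤ ≤_) (eq (u b) (u a)) (sq-mono {1ℤ} (+≤+ ℕ.z≤n) (1≤-diff (≤-<-trans le lt)))
  where
  eq : ∀ x y → (x - y) * (x - y) ≡ (y - x) * (y - x)
  eq = solve-∀

sq≡1 : ∀ {x} → sq x ≡ 1ℤ → 1ℤ ≤ x → x ≡ 1ℤ
sq≡1 {x} e h with i*j≡0⇒i≡0∨j≡0 (x - 1ℤ) {x + 1ℤ} (trans (eq x) (cong (_- 1ℤ) e))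
  where
  eq : ∀ x → (x - 1ℤ) * (x + 1ℤ) ≡ x * x - 1ℤ
  eq = solve-∀
... | inj₁ r = i-j≡0⇒i≡j x 1ℤ r
... | inj₂ r = contradiction (+-monoˡ-≤ 1ℤ h) (<⇒≱ (subst (_< + 2) (sym r) (+<+ (ℕ.s≤s ℕ.z≤n))))

-- If rounding loses no norm, it preserves every squared difference, so each high entry is exactly 1
-- above each low one. The high entry `y₀` links low entries to one another: all lie 1 below it.
up-shape : ∀ {n} (u : Fin n → ℤ) x₀ {y₀} → u x₀ < u y₀ → blk u u ≤ blk (up (u x₀) u) (up (u x₀) u) →
  ∀ x → u x ≡ u x₀ + up (u x₀) u x
up-shape {n} u x₀ {y₀} lt le x = shape (up-cases (u x₀) u x)
  where
  tight : ∀ a b → sq (up (u x₀) u a - up (u x₀) u b) ≡ sq (u a - u b)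
  tight = blk-tight {u = up (u x₀) u} {v = u} (up-sq (u x₀) u) le
  step : ∀ {x y} → u x ≤ u x₀ → u x₀ < u y → u y - u x ≡ 1ℤ
  step {x} {y} h h′ = sq≡1 (trans (sym (tight y x)) (cong₂ (λ a b → sq (a - b)) (up-high u h′) (up-low u h))) (1≤-diff (≤-<-trans h h′))
  eq : ∀ a b → b ≡ a + (b - a)
  eq = solve-∀
  eq′ : ∀ a y → a ≡ y - (y - a)
  eq′ = solve-∀
  shape : (u x₀ < u x × up (u x₀) u x ≡ 1ℤ) ⊎ (u x ≤ u x₀ × up (u x₀) u x ≡ 0ℤ) → u x ≡ u x₀ + up (u x₀) u x
  shape (inj₁ (h , e)) = trans (eq (u x₀) (u x)) (cong (_+_ (u x₀)) (trans (step ≤-refl h) (sym e)))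
  shape (inj₂ (h , e)) = trans
    (trans (eq′ (u x) (u y₀)) (trans (cong (λ d → u y₀ - d) (trans (step h lt) (sym (step ≤-refl lt)))) (sym (eq′ (u x₀) (u y₀)))))
    (trans (sym (+-identityʳ (u x₀))) (cong (_+_ (u x₀)) (sym e)))

01-sum1 : ∀ {n} {f : Fin n → ℤ} → ZeroOne f → sum f ≡ 1ℤ → ∃ λ c → ∀ x → f x ≡ δ c x
01-sum1 {n} {f} h s with Fin.any? (λ c → f c ℤ.≟ 1ℤ)
... | no ¬e = contradiction (trans (sym (sum-zero zeros)) s) λ ()
  where
  zeros : ∀ x → f x ≡ 0ℤ
  zeros x with h x
  ... | inj₁ e = e
  ... | inj₂ e = contradiction (x , e) ¬e
... | yes (c , e) = c , val
  where
  val : ∀ x → f x ≡ δ c x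
  val x with c Fin.≟ x
  ... | yes refl = e
  ... | no c≢x with h x
  ...   | inj₁ e′ = e′
  ...   | inj₂ e′ = contradiction (two-terms c≢x (01-nonneg h)) (<⇒≱ (subst₂ _<_ (sym s) (cong₂ _+_ (sym e) (sym e′)) (+<+ (ℕ.s≤s (ℕ.s≤s ℕ.z≤n)))))

sum-≥2 : ∀ {n} {f : Fin n → ℤ} {a b} → ZeroOne f → a ≢ b → f a ≡ 1ℤ → f b ≡ 1ℤ → + 2 ≤ sum f
sum-≥2 h ne ea eb = subst (_≤ _) (cong₂ _+_ ea eb) (two-terms ne (01-nonneg h))

-- The form on all blocks and its radical.

module _ {k n : ℕ} where

  private
    M = Fin k → Fin n → ℤ

  infixl 6 _⊕_·_
  _⊕_·_ : M → ℤ → M → M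
  (z ⊕ c · w) i x = z i x + c * w i x

  emb : Fin k → (Fin n → ℤ) → M
  emb j v i x = δ j i * v x

  opaque

    B : M → M → ℤ
    B z y = sum (λ i → blk (z i) (y i))

    B-blocks : ∀ z → B z z ≡ sum (λ i → blk (z i) (z i))
    B-blocks z = refl

    B-comm : (z y : M) → B z y ≡ B y z
    B-comm z y = sum-cong-≗ (λ i → blk-comm (z i) (y i))

    B-lin : ∀ (z : M) c (w y : M) → B (z ⊕ c · w) y ≡ B z y + c * B w y
    B-lin z c w y = trans (sum-cong-≗ (λ i → blk-lin c (z i) (w i) (y i))) (sum-lin c (λ i → blk (z i) (y i)) (λ i → blk (w i) (y i)))

    B-linʳ : ∀ (y z : M) c (w : M) → B y (z ⊕ c · w) ≡ B y z + c * B y w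
    B-linʳ y z c w = trans (B-comm y (z ⊕ c · w)) (trans (B-lin z c w y) (cong₂ (λ a b → a + c * b) (B-comm z y) (B-comm w y)))

    B-const : ∀ {z : M} (y : M) → (∀ i a b → z i a ≡ z i b) → B z y ≡ 0ℤ
    B-const {z} y h = sum-zero (λ i → const i)
      where
      const : ∀ i → blk (z i) (y i) ≡ 0ℤ
      const i = go (z i) (y i) (h i)
        where
        go : ∀ {n} (u v : Fin n → ℤ) → (∀ a b → u a ≡ u b) → blk u v ≡ 0ℤ
        -- An empty block has no entry to serve as the constant, so 0 is supplied.
        go {zero} u v h = trans (blk-cong {v = v} (λ ()) (λ _ → refl)) (blk-const 0ℤ v (λ _ → refl))
        go {suc n} u v h = blk-const (u zero) v (λ x → h x zero)

    B≤0⇒const : ∀ {z : M} → B z z ≤ 0ℤ → ∀ i a b → z i a ≡ z i b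
    B≤0⇒const {z} h i = blk≤0⇒const (≤-reflexive (sum-≤0⇒≡0 (λ i → blk-nonneg (z i)) h i))

    B-emb : ∀ j v (y : M) → B (emb j v) y ≡ blk v (y j)
    B-emb j v y = trans (sum-cong-≗ (λ i → blk-scale (δ j i) v (y i))) (sum-δ j (λ i → blk v (y i)))

-- Roots supported in a single block.

1≤⇒2≤ : ∀ {y} → 1ℤ ≤ y → + 2 ≤ y * y + y
1≤⇒2≤ {y} h = ≤-by ((y - 1ℤ) * (y + + 2)) (0≤* (0≤-diff h) (0≤+ (≤-trans (+≤+ ℕ.z≤n) h) (+≤+ ℕ.z≤n))) (eq y)
  where
  eq : ∀ y → y * y + y ≡ + 2 + (y - 1ℤ) * (y + + 2)
  eq = solve-∀

-- The consecutive integers y and y + 1 never have opposite signs.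
0≤y²+y : ∀ y → 0ℤ ≤ y * y + y
0≤y²+y y with 0ℤ ≤? y
... | yes h = 0≤+ (0≤sq y) h
... | no h = subst (0ℤ ≤_) (eq y) (0≤* {0ℤ - y} {0ℤ - y - 1ℤ} (≤-trans (+≤+ ℕ.z≤n) (1≤-diff (≰⇒> h))) (0≤-diff (1≤-diff (≰⇒> h))))
  where
  eq : ∀ y → (0ℤ - y) * (0ℤ - y - 1ℤ) ≡ y * y + y
  eq = solve-∀

prime-∣-sq : ∀ {n} → Prime n → ∀ S k → S * S ≡ k * + n → ∃ λ c → S ≡ c * + n
prime-∣-sq {n} pr S k e with euclidsLemma ℤ.∣ S ∣ ℤ.∣ S ∣ pr (ℕ.divides ℤ.∣ k ∣ (trans (sym (abs-* S S)) (trans (cong ℤ.∣_∣ e) (abs-* k (+ n)))))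
... | inj₁ d = let ℤ.divides c eq = ℤ.∣ᵤ⇒∣ {+ n} {S} d in c , eq
... | inj₂ d = let ℤ.divides c eq = ℤ.∣ᵤ⇒∣ {+ n} {S} d in c , eq

opaque
  unfolding blk

  -- y = w - c has sum 0 and square sum 2, so Σ (y² ± y) = 2 with nonnegative terms, while for
  -- one choice of the sign two of the entries a, l, b₁, b₂ contribute at least 2 each.
  two-square : ∀ {n} .{{_ : ℕ.NonZero n}} (w : Fin n → ℤ) c → sum w ≡ c * + n → blk w w ≡ + 2 * + n → ∀ {a l b₁ b₂ v} → a ≢ l → b₁ ≢ b₂ →
    w b₁ ≡ v → w b₂ ≡ v → w a ≡ v + 1ℤ → v + 1ℤ ≤ w l → ⊥
  two-square {n} w c Sc e {a} {l} {b₁} {b₂} {v} a≢l b₁≢b₂ wb₁ wb₂ wa wl = cases (c ≤? v)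
    where
    open ≡-Reasoning
    T S : ℤ
    T = sum (λ x → w x * w x)
    S = sum w
    -- Equivalent to Σ (w - c)² = 2, since c is the mean of w.
    Tc : T ≡ + 2 + + n * (c * c)
    Tc = *-cancelˡ-≡ (+ n) T (+ 2 + + n * (c * c)) (begin
      + n * T ≡⟨ eq (+ n) T S ⟩
      (+ n * T - S * S) + S * S ≡⟨ cong₂ (λ x y → x + y * y) e Sc ⟩
      + 2 * + n + (c * + n) * (c * + n) ≡⟨ eq′ (+ n) c ⟩
      + n * (+ 2 + + n * (c * c)) ∎)
      where
      eq : ∀ n T S → n * T ≡ (n * T - S * S) + S * S
      eq = solve-∀
      eq′ : ∀ n c → + 2 * n + (c * n) * (c * n) ≡ n * (+ 2 + n * (c * c))
      eq′ = solve-∀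
    f : ℤ → Fin n → ℤ
    f s x = (s * (w x - c)) * (s * (w x - c)) + s * (w x - c)
    sum-f : ∀ s → s * s ≡ 1ℤ → sum (f s) ≡ + 2
    sum-f s ss = begin
      sum (f s) ≡⟨ sum-cong-≗ (λ x → trans (eq s (w x) c) (cong (λ y → y * (w x * w x + (c * c - + 2 * c * w x)) + s * (w x - c)) ss)) ⟩
      sum (λ x → 1ℤ * (w x * w x + (c * c - + 2 * c * w x)) + s * (w x - c)) ≡⟨ sum-cong-≗ (λ x → eq₂ s (w x) c) ⟩
      sum (λ x → (w x * w x + (c * c - s * c)) + (s - + 2 * c) * w x) ≡⟨ sum-lin (s - + 2 * c) (λ x → w x * w x + (c * c - s * c)) w ⟩
      sum (λ x → w x * w x + (c * c - s * c)) + (s - + 2 * c) * S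
        ≡⟨ cong (_+ (s - + 2 * c) * S) (trans (∑-distrib-+ (λ x → w x * w x) (λ _ → c * c - s * c)) (cong (_+_ T) (sum-const n (c * c - s * c)))) ⟩
      (T + + n * (c * c - s * c)) + (s - + 2 * c) * S ≡⟨ cong₂ (λ x y → (x + + n * (c * c - s * c)) + (s - + 2 * c) * y) Tc Sc ⟩
      (+ 2 + + n * (c * c) + + n * (c * c - s * c)) + (s - + 2 * c) * (c * + n) ≡⟨ eq₃ (+ n) s c ⟩
      + 2 ∎
      where
      eq : ∀ s w c → (s * (w - c)) * (s * (w - c)) + s * (w - c) ≡ (s * s) * (w * w + (c * c - + 2 * c * w)) + s * (w - c)
      eq = solve-∀
      eq₂ : ∀ s w c → 1ℤ * (w * w + (c * c - + 2 * c * w)) + s * (w - c) ≡ (w * w + (c * c - s * c)) + (s - + 2 * c) * w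
      eq₂ = solve-∀
      eq₃ : ∀ n s c → (+ 2 + n * (c * c) + n * (c * c - s * c)) + (s - + 2 * c) * (c * n) ≡ + 2
      eq₃ = solve-∀
    impossible : ∀ s → s * s ≡ 1ℤ → ∀ {x y} → x ≢ y → 1ℤ ≤ s * (w x - c) → 1ℤ ≤ s * (w y - c) → ⊥
    impossible s ss {x} {y} x≢y hx hy = contradiction
      (≤-trans (+-mono-≤ (1≤⇒2≤ hx) (1≤⇒2≤ hy)) (subst (f s x + f s y ≤_) (sum-f s ss) (two-terms {f = f s} x≢y (λ x → 0≤y²+y (s * (w x - c))))))
      (<⇒≱ (+<+ (ℕ.s≤s (ℕ.s≤s (ℕ.s≤s ℕ.z≤n)))))
    -- If the mean c is at most v, then `a` and `l` lie at least 1 above it; otherwise `b₁` and `b₂`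
    -- lie at least 1 below it.
    cases : Dec (c ≤ v) → ⊥
    cases (yes c≤v) = impossible 1ℤ refl a≢l (pos a (≤-reflexive (sym wa))) (pos l wl)
      where
      pos : ∀ x → v + 1ℤ ≤ w x → 1ℤ ≤ 1ℤ * (w x - c)
      pos x h = ≤-by ((v - c) + (w x - (v + 1ℤ))) (0≤+ (0≤-diff c≤v) (0≤-diff h)) (eq (w x) c v)
        where
        eq : ∀ w c v → 1ℤ * (w - c) ≡ 1ℤ + ((v - c) + (w - (v + 1ℤ)))
        eq = solve-∀
    cases (no c≰v) = impossible -1ℤ refl b₁≢b₂ (neg b₁ wb₁) (neg b₂ wb₂)
      where
      neg : ∀ x → w x ≡ v → 1ℤ ≤ -1ℤ * (w x - c)
      neg x h = subst (1ℤ ≤_) (trans (eq c v) (cong (λ y → -1ℤ * (y - c)) (sym h))) (1≤-diff (≰⇒> c≰v))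
        where
        eq : ∀ c v → c - v ≡ -1ℤ * (v - c)
        eq = solve-∀

  -- Norm 2 makes the square of the entry sum divisible by the prime n, so the mean is an integer
  -- and the vector lies in A_{n-1}. There the norm 2 vectors are differences of two basis vectors,
  -- with one entry above the mean and one below.
  no-single-block : ∀ {n} → Prime n → (w : Fin n → ℤ) → blk w w ≡ + 2 * + n → ∀ {a l b₁ b₂ v} → a ≢ l → b₁ ≢ b₂ →
    w b₁ ≡ v → w b₂ ≡ v → w a ≡ v + 1ℤ → v + 1ℤ ≤ w l → ⊥
  no-single-block {n} pr w e a≢l b₁≢b₂ wb₁ wb₂ wa wl = two-square {{prime⇒nonZero pr}} w (proj₁ div) (proj₂ div) e a≢l b₁≢b₂ wb₁ wb₂ wa wl
    where
    T S : ℤ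
    T = sum (λ x → w x * w x)
    S = sum w
    eq : ∀ n T S → S * S ≡ n * T - (n * T - S * S)
    eq = solve-∀
    eq′ : ∀ n T → n * T - + 2 * n ≡ (T - + 2) * n
    eq′ = solve-∀
    div : ∃ λ c → S ≡ c * + n
    div = prime-∣-sq pr S (T - + 2) (trans (eq (+ n) T S) (trans (cong (λ y → + n * T - y) e) (eq′ (+ n) T)))

-- The escaping root for p = 5.

t[n-t]≥2[n-2] : ∀ t n → + 2 ≤ t → + 2 ≤ n - t → + 2 * (n - + 2) ≤ t * (n - t)
t[n-t]≥2[n-2] t n h h′ = ≤-by ((t - + 2) * (n - t - + 2)) (0≤* (0≤-diff h) (0≤-diff h′)) (eq t n)
  where
  eq : ∀ t n → t * (n - t) ≡ + 2 * (n - + 2) + (t - + 2) * (n - t - + 2)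
  eq = solve-∀

t[n-t]≥n-1 : ∀ t n → 1ℤ ≤ t → 1ℤ ≤ n - t → n - 1ℤ ≤ t * (n - t)
t[n-t]≥n-1 t n h h′ = ≤-by ((t - 1ℤ) * (n - t - 1ℤ)) (0≤* (0≤-diff h) (0≤-diff h′)) (eq t n)
  where
  eq : ∀ t n → t * (n - t) ≡ n - 1ℤ + (t - 1ℤ) * (n - t - 1ℤ)
  eq = solve-∀

blk-up : ∀ {n} θ (u : Fin n → ℤ) → blk (up θ u) (up θ u) ≤ blk u u
blk-up θ u = blk-mono {u = up θ u} {v = u} (up-sq θ u)

low-compl : ∀ {n θ} (u : Fin n → ℤ) {x} → u x ≤ θ → 1ℤ + -1ℤ * up θ u x ≡ 1ℤ
low-compl u h rewrite up-low u h = refl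

pair : ∀ {n} → Fin n → Fin n → Fin n → ℤ
pair d d′ x = δ d x + δ d′ x

pair-01 : ∀ {n} {d d′ : Fin n} → d ≢ d′ → ZeroOne (pair d d′)
pair-01 {d = d} {d′} ne x with d Fin.≟ x | d′ Fin.≟ x
... | yes refl | yes refl = contradiction refl ne
... | yes _ | no _ = inj₂ refl
... | no _ | yes _ = inj₂ refl
... | no _ | no _ = inj₁ refl

sum-pair : ∀ {n} (d d′ : Fin n) → sum (pair d d′) ≡ + 2
sum-pair d d′ = trans (∑-distrib-+ (δ d) (δ d′)) (cong₂ _+_ (sum-δ₁ d) (sum-δ₁ d′))

two-others : ∀ {n} (c : Fin (3 ℕ.+ n)) → ∃ λ d → ∃ λ d′ → d ≢ d′ × d ≢ c × d′ ≢ c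
two-others zero = suc zero , suc (suc zero) , (λ ()) , (λ ()) , λ ()
two-others (suc zero) = zero , suc (suc zero) , (λ ()) , (λ ()) , λ ()
two-others (suc (suc c)) = zero , suc zero , (λ ()) , (λ ()) , λ ()

-- Supplies the part of the escaping root in the second block, which needs 5 - t ones including one
-- at `c`: for t = 3 a pair containing `c`, for t = 2 the complement of a pair avoiding `c`.
complementary-indicator : ∀ {n} (n≡5 : n ≡ 5) (c : Fin n) {t} → t ≡ + 2 ⊎ t ≡ + 3 →
  ∃ λ (κ : Fin n → ℤ) → ZeroOne κ × κ c ≡ 1ℤ × sum κ ≡ + 5 - t
complementary-indicator refl c (inj₂ refl) = let d , _ , _ , d≢c , _ = two-others c in
  pair c d , pair-01 (≢-sym d≢c) , cong₂ _+_ (δ-refl c) (δ-≢ d≢c) , sum-pair c d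
complementary-indicator refl c (inj₁ refl) = let d , d′ , d≢d′ , d≢c , d′≢c = two-others c in
  (λ x → 1ℤ + -1ℤ * pair d d′ x) , 01-compl (pair-01 d≢d′) ,
  cong (λ y → 1ℤ + -1ℤ * y) (cong₂ _+_ (δ-≢ d≢c) (δ-≢ d′≢c)) ,
  trans (sum-compl (pair d d′)) (cong (λ y → + 5 - y) (sum-pair d d′))

-- A root β whose reflection turns the vector z into z - β, lowering s z_jl by one without
-- changing the other entries of block j relative to each other.
record Escape {k n : ℕ} (z : Fin k → Fin n → ℤ) (j : Fin k) (s : ℤ) (l : Fin n) : Set where
  field
    β      : Fin k → Fin n → ℤ
    N      : ℤ
    sums   : ∀ i → ∃ λ Q → sum (β i) ≡ N * sum (z i) + Q * + n
    norm   : B β β ≡ + 2 * + n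
    zβ     : B z β ≡ + n
    βj     : ∀ x → β j x ≡ s * δ l x
    βconst : ∀ i → (∀ x y → z i x ≡ z i y) → ∀ x → β i x ≡ 0ℤ

-- Here z has norm t(5 - t)/5 = 6/5 in block j and 4/5 in block j′, and β exchanges the two shapes:
-- a single point `l` in block j, of norm 4/5, and the set `κ` of 5 - t points in block j′, of norm
-- 6/5. The choices `l` in `χ` and `c` in `κ` give the products (5 - t)/5 and t/5, so (z, β) = 1.
module _ {k n : ℕ} (n≡5 : + n ≡ + 5) (z : Fin k → Fin n → ℤ) {j j′ : Fin k} (j≢j′ : j ≢ j′)
  {s s′ : ℤ} (ss : s * s ≡ 1ℤ) (ss′ : s′ * s′ ≡ 1ℤ)
  {v v′ t : ℤ} {χ κ : Fin n → ℤ} {c l : Fin n}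
  (zj : ∀ x → z j x ≡ s * v + s * χ x) (Σχ : sum χ ≡ t) (χl : χ l ≡ 1ℤ)
  (zj′ : ∀ x → z j′ x ≡ v′ + s′ * δ c x)
  (zi : ∀ i → i ≢ j → i ≢ j′ → ∃ λ d → ∀ x → z i x ≡ d)
  (nonconst : ¬ (∀ x y → z j x ≡ z j y)) (nonconst′ : ¬ (∀ x y → z j′ x ≡ z j′ y))
  (κ01 : ZeroOne κ) (κc : κ c ≡ 1ℤ) (Σκ : sum κ ≡ + 5 - t) (t6 : t * (+ 5 - t) ≡ + 6)
  where

  open ≡-Reasoning

  private
    sum-const₅ : ∀ d → sum {n} (λ _ → d) ≡ + 5 * d
    sum-const₅ d = trans (sum-const n d) (cong (_* d) n≡5)

    blk-δ₅ : ∀ a (u : Fin n → ℤ) → blk (δ a) u ≡ + 5 * u a - sum u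
    blk-δ₅ a u = trans (blk-δ a u) (cong (λ m → m * u a - sum u) n≡5)

    blk-01₅ : blk κ κ ≡ sum κ * (+ 5 - sum κ)
    blk-01₅ = trans (blk-01 κ01) (cong (λ m → sum κ * (m - sum κ)) n≡5)

    -- t (5 - t) = 6 ≡ 1 mod 5 and Σκ = 5 - t make the word of β a multiple of the word of z.
    β : Fin k → Fin n → ℤ
    β = emb j (λ x → s * δ l x) ⊕ 1ℤ · emb j′ (λ x → s′ * κ x)

    βj : ∀ x → β j x ≡ s * δ l x
    βj x = trans (cong₂ (λ a b → a * (s * δ l x) + 1ℤ * (b * (s′ * κ x))) (δ-refl j) (δ-≢ (≢-sym j≢j′))) (eq (s * δ l x) (s′ * κ x))
      where
      eq : ∀ a b → 1ℤ * a + 1ℤ * (0ℤ * b) ≡ a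
      eq = solve-∀

    βj′ : ∀ x → β j′ x ≡ s′ * κ x
    βj′ x = trans (cong₂ (λ a b → a * (s * δ l x) + 1ℤ * (b * (s′ * κ x))) (δ-≢ j≢j′) (δ-refl j′)) (eq (s * δ l x) (s′ * κ x))
      where
      eq : ∀ a b → 0ℤ * a + 1ℤ * (1ℤ * b) ≡ b
      eq = solve-∀

    βi : ∀ i → i ≢ j → i ≢ j′ → ∀ x → β i x ≡ 0ℤ
    βi i ne ne′ x = trans (cong₂ (λ a b → a * (s * δ l x) + 1ℤ * (b * (s′ * κ x))) (δ-≢ (≢-sym ne)) (δ-≢ (≢-sym ne′))) (eq (s * δ l x) (s′ * κ x))
      where
      eq : ∀ a b → 0ℤ * a + 1ℤ * (0ℤ * b) ≡ 0ℤ
      eq = solve-∀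

    Bβ : ∀ y → B β y ≡ s * (+ 5 * y j l - sum (y j)) + s′ * blk κ (y j′)
    Bβ y = begin
      B β y ≡⟨ B-lin (emb j (λ x → s * δ l x)) 1ℤ (emb j′ (λ x → s′ * κ x)) y ⟩
      B (emb j (λ x → s * δ l x)) y + 1ℤ * B (emb j′ (λ x → s′ * κ x)) y
        ≡⟨ cong₂ (λ a b → a + 1ℤ * b)
             (trans (B-emb j _ y) (trans (blk-scale s (δ l) (y j)) (cong (s *_) (blk-δ₅ l (y j)))))
             (trans (B-emb j′ _ y) (blk-scale s′ κ (y j′))) ⟩
      s * (+ 5 * y j l - sum (y j)) + 1ℤ * (s′ * blk κ (y j′)) ≡⟨ cong (_+_ (s * (+ 5 * y j l - sum (y j)))) (*-identityˡ _) ⟩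
      s * (+ 5 * y j l - sum (y j)) + s′ * blk κ (y j′) ∎

    sum-zj : sum (z j) ≡ + 5 * (s * v) + s * t
    sum-zj = begin
      sum (z j) ≡⟨ sum-cong-≗ zj ⟩
      sum (λ x → s * v + s * χ x) ≡⟨ sum-lin s (λ _ → s * v) χ ⟩
      sum {n} (λ _ → s * v) + s * sum χ ≡⟨ cong₂ (λ a b → a + s * b) (sum-const₅ (s * v)) Σχ ⟩
      + 5 * (s * v) + s * t ∎

    sum-zj′ : sum (z j′) ≡ + 5 * v′ + s′
    sum-zj′ = begin
      sum (z j′) ≡⟨ sum-cong-≗ zj′ ⟩
      sum (λ x → v′ + s′ * δ c x) ≡⟨ sum-lin s′ (λ _ → v′) (δ c) ⟩
      sum {n} (λ _ → v′) + s′ * sum (δ c) ≡⟨ cong₂ (λ a b → a + s′ * b) (sum-const₅ v′) (sum-δ₁ c) ⟩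
      + 5 * v′ + s′ * 1ℤ ≡⟨ cong (_+_ (+ 5 * v′)) (*-identityʳ s′) ⟩
      + 5 * v′ + s′ ∎

    blk-κ-zj′ : blk κ (z j′) ≡ s′ * t
    blk-κ-zj′ = begin
      blk κ (z j′) ≡⟨ trans (blk-cong {u = κ} (λ _ → refl) zj′) (blk-comm κ _) ⟩
      blk (λ x → v′ + s′ * δ c x) κ ≡⟨ blk-lin s′ (λ _ → v′) (δ c) κ ⟩
      blk (λ _ → v′) κ + s′ * blk (δ c) κ ≡⟨ cong₂ (λ a b → a + s′ * b) (blk-const v′ κ (λ _ → refl)) (blk-δ₅ c κ) ⟩
      0ℤ + s′ * (+ 5 * κ c - sum κ) ≡⟨ cong₂ (λ a b → 0ℤ + s′ * (+ 5 * a - b)) κc Σκ ⟩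
      0ℤ + s′ * (+ 5 * 1ℤ - (+ 5 - t)) ≡⟨ eq s′ t ⟩
      s′ * t ∎
      where
      eq : ∀ s t → 0ℤ + s * (+ 5 * 1ℤ - (+ 5 - t)) ≡ s * t
      eq = solve-∀

    zβ : B z β ≡ + 5
    zβ = begin
      B z β ≡⟨ trans (B-comm z β) (Bβ z) ⟩
      s * (+ 5 * z j l - sum (z j)) + s′ * blk κ (z j′)
        ≡⟨ cong₂ (λ a b → s * (+ 5 * a - sum (z j)) + s′ * b) (trans (zj l) (cong (λ y → s * v + s * y) χl)) blk-κ-zj′ ⟩
      s * (+ 5 * (s * v + s * 1ℤ) - sum (z j)) + s′ * (s′ * t)
        ≡⟨ cong (λ a → s * (+ 5 * (s * v + s * 1ℤ) - a) + s′ * (s′ * t)) sum-zj ⟩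
      s * (+ 5 * (s * v + s * 1ℤ) - (+ 5 * (s * v) + s * t)) + s′ * (s′ * t) ≡⟨ eq s s′ v t ⟩
      (s * s) * (+ 5 - t) + (s′ * s′) * t ≡⟨ cong₂ (λ a b → a * (+ 5 - t) + b * t) ss ss′ ⟩
      1ℤ * (+ 5 - t) + 1ℤ * t ≡⟨ eq′ t ⟩
      + 5 ∎
      where
      eq : ∀ s s′ v t → s * (+ 5 * (s * v + s * 1ℤ) - (+ 5 * (s * v) + s * t)) + s′ * (s′ * t) ≡ (s * s) * (+ 5 - t) + (s′ * s′) * t
      eq = solve-∀
      eq′ : ∀ t → 1ℤ * (+ 5 - t) + 1ℤ * t ≡ + 5
      eq′ = solve-∀

    norm : B β β ≡ + 10
    norm = begin
      B β β ≡⟨ Bβ β ⟩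
      s * (+ 5 * β j l - sum (β j)) + s′ * blk κ (β j′)
        ≡⟨ cong₂ (λ a b → s * (+ 5 * a - b) + s′ * blk κ (β j′)) (trans (βj l) (cong (s *_) (δ-refl l)))
             (trans (sum-cong-≗ βj) (trans (sum-scale s (δ l)) (cong (s *_) (sum-δ₁ l)))) ⟩
      s * (+ 5 * (s * 1ℤ) - s * 1ℤ) + s′ * blk κ (β j′)
        ≡⟨ cong (λ a → s * (+ 5 * (s * 1ℤ) - s * 1ℤ) + s′ * a)
             (trans (trans (blk-comm κ (β j′)) (blk-cong {v = κ} βj′ (λ _ → refl))) (trans (blk-scale s′ κ κ) (cong (s′ *_) (trans blk-01₅ (cong (λ a → a * (+ 5 - a)) Σκ))))) ⟩
      s * (+ 5 * (s * 1ℤ) - s * 1ℤ) + s′ * (s′ * ((+ 5 - t) * (+ 5 - (+ 5 - t)))) ≡⟨ eq s s′ t ⟩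
      (s * s) * + 4 + (s′ * s′) * (t * (+ 5 - t)) ≡⟨ cong₂ (λ a b → a * + 4 + b * (t * (+ 5 - t))) ss ss′ ⟩
      1ℤ * + 4 + 1ℤ * (t * (+ 5 - t)) ≡⟨ cong (λ a → 1ℤ * + 4 + 1ℤ * a) t6 ⟩
      + 10 ∎
      where
      eq : ∀ s s′ t → s * (+ 5 * (s * 1ℤ) - s * 1ℤ) + s′ * (s′ * ((+ 5 - t) * (+ 5 - (+ 5 - t)))) ≡ (s * s) * + 4 + (s′ * s′) * (t * (+ 5 - t))
      eq = solve-∀

    sums : ∀ i → ∃ λ Q → sum (β i) ≡ (+ 5 - t) * sum (z i) + Q * + 5
    sums i with i Fin.≟ j | i Fin.≟ j′
    ... | yes refl | _ = - ((+ 5 - t) * (s * v) + s) , (begin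
      sum (β j) ≡⟨ trans (sum-cong-≗ βj) (trans (sum-scale s (δ l)) (cong (s *_) (sum-δ₁ l))) ⟩
      s * 1ℤ ≡⟨ eq₁ s ⟩
      s * + 6 - s * + 5 ≡⟨ cong (λ a → s * a - s * + 5) (sym t6) ⟩
      s * (t * (+ 5 - t)) - s * + 5 ≡⟨ eq₂ s t v ⟩
      (+ 5 - t) * (+ 5 * (s * v) + s * t) + - ((+ 5 - t) * (s * v) + s) * + 5 ≡⟨ cong (λ a → (+ 5 - t) * a + - ((+ 5 - t) * (s * v) + s) * + 5) (sym sum-zj) ⟩
      (+ 5 - t) * sum (z j) + - ((+ 5 - t) * (s * v) + s) * + 5 ∎)
      where
      eq₁ : ∀ s → s * 1ℤ ≡ s * + 6 - s * + 5
      eq₁ = solve-∀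
      eq₂ : ∀ s t v → s * (t * (+ 5 - t)) - s * + 5 ≡ (+ 5 - t) * (+ 5 * (s * v) + s * t) + - ((+ 5 - t) * (s * v) + s) * + 5
      eq₂ = solve-∀
    ... | no _ | yes refl = - ((+ 5 - t) * v′) , (begin
      sum (β j′) ≡⟨ trans (sum-cong-≗ βj′) (trans (sum-scale s′ κ) (cong (s′ *_) Σκ)) ⟩
      s′ * (+ 5 - t) ≡⟨ eq s′ t v′ ⟩
      (+ 5 - t) * (+ 5 * v′ + s′) + - ((+ 5 - t) * v′) * + 5 ≡⟨ cong (λ a → (+ 5 - t) * a + - ((+ 5 - t) * v′) * + 5) (sym sum-zj′) ⟩
      (+ 5 - t) * sum (z j′) + - ((+ 5 - t) * v′) * + 5 ∎)
      where
      eq : ∀ s t v → s * (+ 5 - t) ≡ (+ 5 - t) * (+ 5 * v + s) + - ((+ 5 - t) * v) * + 5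
      eq = solve-∀
    ... | no ne | no ne′ = let d , zid = zi i ne ne′ in - ((+ 5 - t) * d) , (begin
      sum (β i) ≡⟨ sum-zero (βi i ne ne′) ⟩
      0ℤ ≡⟨ eq t d ⟩
      (+ 5 - t) * (+ 5 * d) + - ((+ 5 - t) * d) * + 5
        ≡⟨ cong (λ a → (+ 5 - t) * a + - ((+ 5 - t) * d) * + 5) (sym (trans (sum-cong-≗ zid) (sum-const₅ d))) ⟩
      (+ 5 - t) * sum (z i) + - ((+ 5 - t) * d) * + 5 ∎)
      where
      eq : ∀ t c → 0ℤ ≡ (+ 5 - t) * (+ 5 * c) + - ((+ 5 - t) * c) * + 5
      eq = solve-∀

  escape₅ : Escape z j s l
  escape₅ = record
    { β = β ; N = + 5 - t
    ; sums = λ i → let Q , e = sums i in Q , trans e (cong (λ m → (+ 5 - t) * sum (z i) + Q * m) (sym n≡5))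
    ; norm = trans norm (cong (+ 2 *_) (sym n≡5)) ; zβ = trans zβ (sym n≡5) ; βj = βj
    ; βconst = λ i h → βi i (λ { refl → nonconst h }) (λ { refl → nonconst′ h }) }

-- The norm estimate that forces p = 5.

signed-single : ∀ {n} (f : Fin n → ℤ) → ZeroOne f → sum f ≡ 1ℤ ⊎ + n - sum f ≡ 1ℤ →
  ∃ λ c → ∃ λ s → ∃ λ d → s * s ≡ 1ℤ × (∀ x → f x ≡ d + s * δ c x)
signed-single f h (inj₁ e) = let c , fc = 01-sum1 h e in
  c , 1ℤ , 0ℤ , refl , λ x → trans (fc x) (eq (δ c x))
  where
  eq : ∀ y → y ≡ 0ℤ + 1ℤ * y
  eq = solve-∀
signed-single f h (inj₂ e) = let c , fc = 01-sum1 (01-compl h) (trans (sum-compl f) e) in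
  c , -1ℤ , 1ℤ , refl , λ x → trans (eq (f x)) (cong (λ y → 1ℤ + -1ℤ * y) (fc x))
  where
  eq : ∀ y → y ≡ 1ℤ + -1ℤ * (1ℤ + -1ℤ * y)
  eq = solve-∀

-- The estimate reads 3n - 5 ≤ 2n, so n is 4 or 5, and parity excludes 4.
n≡5-bound : ∀ {n} → ¬ 2 ∣ n → + 4 ≤ + n → + 2 * (+ n - + 2) + (+ n - 1ℤ) ≤ + 2 * + n → n ≡ 5
n≡5-bound {n} odd 4≤n h = go n odd (drop‿+≤+ 4≤n) (drop‿+≤+ (≤-by {+ n} (+ 2 * + n - (+ 2 * (+ n - + 2) + (+ n - 1ℤ))) (0≤-diff h) (eq (+ n))))
  where
  eq : ∀ n → + 5 ≡ n + (+ 2 * n - (+ 2 * (n - + 2) + (n - 1ℤ)))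
  eq = solve-∀
  go : ∀ n → ¬ 2 ∣ n → 4 ℕ.≤ n → n ℕ.≤ 5 → n ≡ 5
  go n odd lo hi with ℕ.m≤n⇒m<n∨m≡n hi
  ... | inj₂ e = e
  ... | inj₁ lt = contradiction (ℕ.divides 2 (ℕ.≤-antisym (ℕ.s≤s⁻¹ lt) lo)) odd

-- Two entries above `v` and two equal to `v` give the threshold indicator `χ` a size t with 2 ≤ t ≤
-- n - 2. On that range t(n - t) is smallest at the ends, which bounds the norm of block j from
-- below by 2(n - 2)/n.
module _ {k n : ℕ} (odd : ¬ 2 ∣ n) (z : Fin k → Fin n → ℤ) (norm-z : B z z ≡ + 2 * + n)
  (j : Fin k) {s : ℤ} (ss : s * s ≡ 1ℤ) {a l b₁ b₂ : Fin n} (a≢l : a ≢ l) (b₁≢b₂ : b₁ ≢ b₂)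
  (eb : s * z j b₂ ≡ s * z j b₁) (ea : s * z j a ≡ s * z j b₁ + 1ℤ) (el : s * z j b₁ + 1ℤ ≤ s * z j l)
  where

  private
    w : Fin n → ℤ
    w x = s * z j x
    v = w b₁

    v<v+1 : v < v + 1ℤ
    v<v+1 = subst (_< v + 1ℤ) (+-identityʳ v) (+-monoʳ-< v (+<+ (ℕ.s≤s ℕ.z≤n)))

    w-scale : blk w w ≡ blk (z j) (z j)
    w-scale = trans (blk-scale s (z j) w) (trans (cong (s *_) (trans (blk-comm (z j) w) (blk-scale s (z j) (z j))))
      (trans (sym (*-assoc s s (blk (z j) (z j)))) (trans (cong (_* blk (z j) (z j)) ss) (*-identityˡ _))))

    z-w : ∀ x → z j x ≡ s * w x
    z-w x = trans (sym (*-identityˡ (z j x))) (trans (cong (_* z j x) (sym ss)) (*-assoc s s (z j x)))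

    χ : Fin n → ℤ
    χ = up v w
    t = sum χ

    v<wa : v < w a
    v<wa = subst (v <_) (sym ea) v<v+1

    v<wl : v < w l
    v<wl = <-≤-trans v<v+1 el

    2≤t : + 2 ≤ t
    2≤t = sum-≥2 (up-01 v w) a≢l (up-high w v<wa) (up-high w v<wl)

    2≤n-t : + 2 ≤ + n - t
    2≤n-t = subst (+ 2 ≤_) (sum-compl χ)
      (sum-≥2 (01-compl (up-01 v w)) b₁≢b₂ (low-compl w ≤-refl) (low-compl w (≤-reflexive eb)))

    blk-χ : + 2 * (+ n - + 2) ≤ blk χ χ
    blk-χ = subst (_ ≤_) (sym (blk-01 (up-01 v w))) (t[n-t]≥2[n-2] t (+ n) 2≤t 2≤n-t)

    4≤n : + 4 ≤ + n
    4≤n = subst (+ 4 ≤_) (eq t (+ n)) (+-mono-≤ 2≤t 2≤n-t)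
      where
      eq : ∀ t n → t + (n - t) ≡ n
      eq = solve-∀

    blocks-nonneg : ∀ i → 0ℤ ≤ blk (z i) (z i)
    blocks-nonneg i = blk-nonneg (z i)

    sum-blocks : sum (λ i → blk (z i) (z i)) ≡ + 2 * + n
    sum-blocks = trans (sym (B-blocks z)) norm-z

    -- A second non-constant block has rounded norm at least (n - 1)/n. Once n = 5, the bounds 6/5
    -- and 4/5 exhaust the total norm 2: both blocks equal their rounding up to a constant, and no
    -- norm is left for a third block.
    module Other (j′ : Fin k) (j′≢j : j′ ≢ j) (x₀ y₀ : Fin n) (x₀<y₀ : z j′ x₀ < z j′ y₀) where

      w′ χ′ : Fin n → ℤ
      w′ = z j′
      χ′ = up (w′ x₀) w′
      t′ = sum χ′

      1≤t′ : 1ℤ ≤ t′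
      1≤t′ = subst (_≤ t′) (up-high w′ x₀<y₀) (one-term y₀ (01-nonneg (up-01 (w′ x₀) w′)))

      1≤n-t′ : 1ℤ ≤ + n - t′
      1≤n-t′ = subst₂ _≤_ (low-compl w′ ≤-refl) (sum-compl χ′) (one-term x₀ (01-nonneg (01-compl (up-01 (w′ x₀) w′))))

      blk-χ′ : + n - 1ℤ ≤ blk χ′ χ′
      blk-χ′ = subst (_ ≤_) (sym (blk-01 (up-01 (w′ x₀) w′))) (t[n-t]≥n-1 t′ (+ n) 1≤t′ 1≤n-t′)

      two-blocks : blk w w + blk w′ w′ ≤ + 2 * + n
      two-blocks = subst₂ (λ x y → x + blk w′ w′ ≤ y) (sym w-scale) sum-blocks (two-terms (≢-sym j′≢j) blocks-nonneg)

      n≡5 : n ≡ 5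
      n≡5 = n≡5-bound odd 4≤n (≤-trans (+-mono-≤ (≤-trans blk-χ (blk-up v w)) (≤-trans blk-χ′ (blk-up (w′ x₀) w′))) two-blocks)

      +n≡5 : + n ≡ + 5
      +n≡5 = cong +_ n≡5

      6≤χ : + 6 ≤ blk χ χ
      6≤χ = subst (λ m → + 2 * (m - + 2) ≤ blk χ χ) +n≡5 blk-χ

      4≤χ′ : + 4 ≤ blk χ′ χ′
      4≤χ′ = subst (λ m → m - 1ℤ ≤ blk χ′ χ′) +n≡5 blk-χ′

      two-blocks₅ : blk w w + blk w′ w′ ≤ + 10
      two-blocks₅ = subst (λ m → blk w w + blk w′ w′ ≤ + 2 * m) +n≡5 two-blocks

      w≤6 : blk w w ≤ + 6
      w≤6 = ≤-by ((+ 10 - (blk w w + blk w′ w′)) + (blk w′ w′ - + 4))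
        (0≤+ (0≤-diff two-blocks₅) (0≤-diff (≤-trans 4≤χ′ (blk-up (w′ x₀) w′)))) (eq (blk w w) (blk w′ w′))
        where
        eq : ∀ a b → + 6 ≡ a + ((+ 10 - (a + b)) + (b - + 4))
        eq = solve-∀

      w′≤4 : blk w′ w′ ≤ + 4
      w′≤4 = ≤-by ((+ 10 - (blk w w + blk w′ w′)) + (blk w w - + 6))
        (0≤+ (0≤-diff two-blocks₅) (0≤-diff (≤-trans 6≤χ (blk-up v w)))) (eq (blk w w) (blk w′ w′))
        where
        eq : ∀ a b → + 4 ≡ b + ((+ 10 - (a + b)) + (a - + 6))
        eq = solve-∀

      shape : ∀ x → w x ≡ v + χ x
      shape = up-shape w b₁ v<wa (≤-trans w≤6 6≤χ)

      shape′ : ∀ x → w′ x ≡ w′ x₀ + χ′ x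
      shape′ = up-shape w′ x₀ x₀<y₀ (≤-trans w′≤4 4≤χ′)

      t6 : t * (+ 5 - t) ≡ + 6
      t6 = trans (cong (λ m → t * (m - t)) (sym +n≡5)) (trans (sym (blk-01 (up-01 v w)))
        (≤-antisym (≤-trans (blk-up v w) w≤6) 6≤χ))

      t∈ : t ≡ + 2 ⊎ t ≡ + 3
      t∈ = Sum.map (i-j≡0⇒i≡j t (+ 2)) (i-j≡0⇒i≡j t (+ 3))
        (i*j≡0⇒i≡0∨j≡0 (t - + 2) {t - + 3} (trans (eq t) (cong (λ y → + 6 - y) t6)))
        where
        eq : ∀ t → (t - + 2) * (t - + 3) ≡ + 6 - t * (+ 5 - t)
        eq = solve-∀

      t′4 : t′ * (+ n - t′) ≡ + 4
      t′4 = trans (sym (blk-01 (up-01 (w′ x₀) w′))) (≤-antisym (≤-trans (blk-up (w′ x₀) w′) w′≤4) 4≤χ′)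

      t′∈ : t′ ≡ 1ℤ ⊎ + n - t′ ≡ 1ℤ
      t′∈ = Sum.map (i-j≡0⇒i≡j t′ 1ℤ) (i-j≡0⇒i≡j (+ n - t′) 1ℤ)
        (i*j≡0⇒i≡0∨j≡0 (t′ - 1ℤ) {+ n - t′ - 1ℤ} (trans (eq t′ (+ n)) (cong₂ (λ y m → y - m + 1ℤ) t′4 +n≡5)))
        where
        eq : ∀ t n → (t - 1ℤ) * (n - t - 1ℤ) ≡ t * (n - t) - n + 1ℤ
        eq = solve-∀

      rest : ∀ i → i ≢ j → i ≢ j′ → ∃ λ d → ∀ x → z i x ≡ d
      rest i i≢j i≢j′ = z i a , λ x → blk≤0⇒const (≤-by _ (0≤+ (0≤-diff three) (0≤+ (0≤-diff lo) (0≤-diff lo′)))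
          (eq (blk (z j) (z j)) (blk w′ w′) (blk (z i) (z i)))) x a
        where
        three : blk (z j) (z j) + (blk w′ w′ + blk (z i) (z i)) ≤ + 10
        three = subst (_ ≤_) (trans sum-blocks (cong (+ 2 *_) +n≡5)) (three-terms (≢-sym j′≢j) (≢-sym i≢j) (≢-sym i≢j′) blocks-nonneg)
        lo : + 6 ≤ blk (z j) (z j)
        lo = subst (+ 6 ≤_) w-scale (≤-trans 6≤χ (blk-up v w))
        lo′ : + 4 ≤ blk w′ w′
        lo′ = ≤-trans 4≤χ′ (blk-up (w′ x₀) w′)
        eq : ∀ a b c → 0ℤ ≡ c + ((+ 10 - (a + (b + c))) + ((a - + 6) + (b - + 4)))
        eq = solve-∀

      χl : χ l ≡ 1ℤ
      χl = up-high w v<wl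

      wl : w l ≡ v + 1ℤ
      wl = trans (shape l) (cong (_+_ v) χl)

      result : Escape z j s l
      result = build (signed-single χ′ (up-01 (w′ x₀) w′) t′∈)
        where
        build : (∃ λ c → ∃ λ s → ∃ λ d → s * s ≡ 1ℤ × (∀ x → χ′ x ≡ d + s * δ c x)) → Escape z j s l
        build (c , s′ , d , ss′ , fc) = from-indicator (complementary-indicator n≡5 c t∈)
          where
          from-indicator : (∃ λ (κ : Fin n → ℤ) → ZeroOne κ × κ c ≡ 1ℤ × sum κ ≡ + 5 - t) → Escape z j s l
          from-indicator (κ , κ01 , κc , Σκ) = escape₅ +n≡5 z (≢-sym j′≢j) {s} {s′} ss ss′ {v} {w′ x₀ + d} {t} {χ} {κ} {c} {l}
            (λ x → trans (z-w x) (trans (cong (s *_) (shape x)) (*-distribˡ-+ s v (χ x)))) refl χl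
            (λ x → trans (shape′ x) (trans (cong (_+_ (w′ x₀)) (fc x)) (sym (+-assoc (w′ x₀) d (s′ * δ c x)))))
            rest (λ h → <-irrefl (cong (s *_) (h b₁ a)) v<wa) (λ h → <-irrefl (h x₀ y₀) x₀<y₀)
            κ01 κc Σκ t6

  -- Either some other block is non-constant and `Other` applies, or z lives in block j alone,
  -- against `no-single-block`. Tightness also puts `l` on the same level as `a`, so that (u, τ) is
  -- exactly 0 where this is applied.
  escape : Prime n → Escape z j s l × s * z j l ≡ s * z j a
  escape pr with Fin.any? (λ i → ¬? (i Fin.≟ j) ×-dec Fin.any? (λ x → Fin.any? (λ y → z i x <? z i y)))
  ... | yes (j′ , j′≢j , x₀ , y₀ , lt) = Other.result j′ j′≢j x₀ y₀ lt , trans (Other.wl j′ j′≢j x₀ y₀ lt) (sym ea)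
  ... | no none = ⊥-elim (no-single-block pr w (trans w-scale only-j) a≢l b₁≢b₂ refl eb ea el)
    where
    const : ∀ i → i ≢ j → ∀ x → z i x ≡ z i a
    const i i≢j x = ≤-antisym (≮⇒≥ (λ lt → none (i , i≢j , a , x , lt))) (≮⇒≥ (λ lt → none (i , i≢j , x , a , lt)))
    masked : ∀ i → mask j (λ i → blk (z i) (z i)) i ≡ 0ℤ
    masked i with j Fin.≟ i
    ... | yes refl = eq (blk (z j) (z j))
      where
      eq : ∀ y → y + -1ℤ * (1ℤ * y) ≡ 0ℤ
      eq = solve-∀
    ... | no j≢i rewrite blk-const (z i a) {z i} (z i) (const i (≢-sym j≢i)) = refl
    only-j : blk (z j) (z j) ≡ + 2 * + n
    only-j = trans (sym (+-identityʳ _)) (trans (cong (_+_ (blk (z j) (z j))) (sym (sum-zero masked)))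
      (trans (sym (sum-mask j (λ i → blk (z i) (z i)))) sum-blocks))

-- Congruences, words of arrays, and integrality.

module Congruence (m : ℤ) where

  infix 4 _∼_
  -- The quotient is kept as data because it reappears as a coordinate shift in `Mem⇒LA`.
  record _∼_ (x y : ℤ) : Set where
    constructor by
    field
      quotient : ℤ
      equality : x ≡ y + quotient * m

  open _∼_ public

  ∼-reflexive : ∀ {x y} → x ≡ y → x ∼ y
  ∼-reflexive {y = y} e = by 0ℤ (trans e (eq y m))
    where
    eq : ∀ y m → y ≡ y + 0ℤ * m
    eq = solve-∀

  ∼-sym : ∀ {x y} → x ∼ y → y ∼ x
  ∼-sym {y = y} (by Q refl) = by (- Q) (eq y Q m)
    where
    eq : ∀ y Q m → y ≡ (y + Q * m) + - Q * m
    eq = solve-∀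

  ∼-trans : ∀ {x y z} → x ∼ y → y ∼ z → x ∼ z
  ∼-trans {z = z} (by Q refl) (by R refl) = by (R + Q) (eq z R Q m)
    where
    eq : ∀ z R Q m → (z + R * m) + Q * m ≡ z + (R + Q) * m
    eq = solve-∀

  ∼-+ : ∀ {x y z w} → x ∼ y → z ∼ w → x + z ∼ y + w
  ∼-+ {y = y} {w = w} (by Q refl) (by R refl) = by (Q + R) (eq y w Q R m)
    where
    eq : ∀ y w Q R m → (y + Q * m) + (w + R * m) ≡ (y + w) + (Q + R) * m
    eq = solve-∀

  ∼-* : ∀ {x y z w} → x ∼ y → z ∼ w → x * z ∼ y * w
  ∼-* {y = y} {w = w} (by Q refl) (by R refl) = by (y * R + Q * w + Q * R * m) (eq y w Q R m)
    where
    eq : ∀ y w Q R m → (y + Q * m) * (w + R * m) ≡ y * w + (y * R + Q * w + Q * R * m) * m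
    eq = solve-∀

  ∼-neg : ∀ {x y} → x ∼ y → - x ∼ - y
  ∼-neg {y = y} (by Q refl) = by (- Q) (eq y Q m)
    where
    eq : ∀ y Q m → - (y + Q * m) ≡ - y + - Q * m
    eq = solve-∀

  ∼-sum : ∀ {k} {f g : Fin k → ℤ} → (∀ i → f i ∼ g i) → sum f ∼ sum g
  ∼-sum {zero} h = ∼-reflexive refl
  ∼-sum {suc k} h = ∼-+ (h zero) (∼-sum (h ∘ suc))

module Code (q : ℕ) where

  p : ℕ
  p = suc q

  open Congruence (+ p) public

  ⟦_⟧ : Fin p → ℤ
  ⟦ a ⟧ = + toℕ a

  ⟦mod⟧ : ∀ m → ⟦ m mod p ⟧ ∼ + m
  ⟦mod⟧ m = ∼-sym (by (+ (m / p)) (trans (cong +_ (m≡m%n+[m/n]*n m p))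
    (cong₂ _+_ (cong +_ (sym (Fin.toℕ-fromℕ< (m%n<n m p)))) (pos-* (m / p) p))))

  ⟦+⟧ : ∀ a b → ⟦ _+F_ p a b ⟧ ∼ ⟦ a ⟧ + ⟦ b ⟧
  ⟦+⟧ a b = ⟦mod⟧ (toℕ a ℕ.+ toℕ b)

  ⟦*⟧ : ∀ a b → ⟦ _*F_ p a b ⟧ ∼ ⟦ a ⟧ * ⟦ b ⟧
  ⟦*⟧ a b = ∼-trans (⟦mod⟧ (toℕ a ℕ.* toℕ b)) (∼-reflexive (pos-* (toℕ a) (toℕ b)))

  ⟦-⟧ : ∀ a → ⟦ -F_ p a ⟧ ∼ - ⟦ a ⟧
  ⟦-⟧ a = ∼-trans (⟦mod⟧ (p ℕ.∸ toℕ a)) (by 1ℤ (trans (sym (≤-⊖ (ℕ.<⇒≤ (Fin.toℕ<n a))))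
    (trans (sym (m-n≡m⊖n p (toℕ a))) (eq (+ p) ⟦ a ⟧))))
    where
    eq : ∀ p a → p - a ≡ - a + 1ℤ * p
    eq = solve-∀

  residue : ∀ c → ∃ λ (a : Fin p) → ⟦ a ⟧ ∼ c
  residue c = (c %ℕ p) mod p , ∼-trans (⟦mod⟧ (c %ℕ p)) (∼-sym (by (c /ℕ p) (a≡a%ℕn+[a/ℕn]*n c p)))

  ⟦⟧-injective : ∀ {a b} → ⟦ a ⟧ ∼ ⟦ b ⟧ → a ≡ b
  ⟦⟧-injective {a} {b} (by Q e) = Fin.toℕ-injective (cases Q e)
    where
    large : ∀ (c d : Fin p) r → toℕ c ≡ toℕ d ℕ.+ suc r ℕ.* p → toℕ c ≡ toℕ d
    large c d r e = contradiction (Fin.toℕ<n c) (ℕ.≤⇒≯ (subst (p ℕ.≤_) (sym e) (ℕ.≤-trans (ℕ.m≤m+n p (r ℕ.* p)) (ℕ.m≤n+m _ (toℕ d)))))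
    eq : ∀ a b Q m → a ≡ b + Q * m → b ≡ a + - Q * m
    eq a b Q m refl = eq′ b Q m
      where
      eq′ : ∀ b Q m → b ≡ (b + Q * m) + - Q * m
      eq′ = solve-∀
    cases : ∀ Q → ⟦ a ⟧ ≡ ⟦ b ⟧ + Q * + p → toℕ a ≡ toℕ b
    cases (+ zero) e = +-injective (trans e (+-identityʳ ⟦ b ⟧))
    cases (+ suc r) e = large a b r (+-injective (trans e (cong (_+_ ⟦ b ⟧) (sym (pos-* (suc r) p)))))
    cases -[1+ r ] e = sym (large b a r (+-injective (trans (eq ⟦ a ⟧ ⟦ b ⟧ -[1+ r ] (+ p) e) (cong (_+_ ⟦ a ⟧) (sym (pos-* (suc r) p))))))

  ⟦dot⟧ : ∀ {k} (x y : Vec (Fin p) k) → ⟦ dot p x y ⟧ ∼ sum (λ i → ⟦ lookup x i ⟧ * ⟦ lookup y i ⟧)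
  ⟦dot⟧ [] [] = ⟦mod⟧ 0
  ⟦dot⟧ (x ∷ xs) (y ∷ ys) = ∼-trans (⟦+⟧ (_*F_ p x y) (dot p xs ys)) (∼-+ (⟦*⟧ x y) (⟦dot⟧ xs ys))

  M : ℕ → Set
  M k = Fin k → Fin p → ℤ

  -- Every projected basis vector is congruent to ε₁ modulo A_{p-1}, so the class of a block in A*/A
  -- is its entry sum modulo p.
  Word : ∀ {k} → M k → Vec (Fin p) k → Set
  Word z a = ∀ i → sum (z i) ∼ ⟦ lookup a i ⟧

  Mem : ∀ {k} → (Vec (Fin p) k → Set) → M k → Set
  Mem C z = ∃ λ a → C a × Word z a

  opaque
    unfolding B blk

    -- Modulo p only the product of the two entry sums survives in `blk`, with a minus sign.
    B∼dot : ∀ {k} (z y : M k) {a b} → Word z a → Word y b → B z y ∼ - ⟦ dot p a b ⟧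
    B∼dot z y {a} {b} za yb = ∼-trans (∼-sum {g = λ i → -1ℤ * (⟦ lookup a i ⟧ * ⟦ lookup b i ⟧)} block)
      (∼-trans (∼-reflexive (trans (sum-scale -1ℤ (λ i → ⟦ lookup a i ⟧ * ⟦ lookup b i ⟧)) (-1*i≡-i _)))
        (∼-neg (∼-sym (⟦dot⟧ a b))))
      where
      eq : ∀ p t s → p * t - s ≡ -1ℤ * s + t * p
      eq = solve-∀
      block : ∀ i → + p * sum (λ x → z i x * y i x) - sum (z i) * sum (y i) ∼ -1ℤ * (⟦ lookup a i ⟧ * ⟦ lookup b i ⟧)
      block i = ∼-trans (by (sum (λ x → z i x * y i x)) (eq (+ p) (sum (λ x → z i x * y i x)) (sum (z i) * sum (y i))))
        (∼-* (∼-reflexive { -1ℤ} refl) (∼-* (za i) (yb i)))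

  module Subspace {k} {C : Vec (Fin p) k → Set} (isC : IsSubspace p C) where
    open IsSubspace isC

    Mem-combination : ∀ {z w : M k} c → Mem C z → Mem C w → Mem C (z ⊕ c · w)
    Mem-combination {z} {w} c (a , Ca , za) (b , Cb , wb) = let r , r∼c = residue c in
      zipWith (_+F_ p) a (map (_*F_ p r) b) , add-mem a (map (_*F_ p r) b) Ca (smul-mem r b Cb) , λ i →
        ∼-trans (∼-trans (∼-reflexive (sum-lin c (z i) (w i))) (∼-+ (za i) (∼-* (∼-sym r∼c) (wb i))))
          (∼-sym (∼-trans (∼-reflexive (cong ⟦_⟧ (lookup-zipWith (_+F_ p) i a (map (_*F_ p r) b))))
            (∼-trans (⟦+⟧ (lookup a i) (lookup (map (_*F_ p r) b) i))
              (∼-+ (∼-reflexive {⟦ lookup a i ⟧} refl) (∼-trans (∼-reflexive (cong ⟦_⟧ (lookup-map i (_*F_ p r) b))) (⟦*⟧ r (lookup b i)))))))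

    Mem-multiple : ∀ {z w : M k} c → Mem C z → (∀ i → sum (w i) ∼ c * sum (z i)) → Mem C w
    Mem-multiple {z} {w} c (a , Ca , za) h = let r , r∼c = residue c in
      map (_*F_ p r) a , smul-mem r a Ca , λ i → ∼-trans (h i) (∼-trans (∼-* (∼-sym r∼c) (za i))
        (∼-sym (∼-trans (∼-reflexive (cong ⟦_⟧ (lookup-map i (_*F_ p r) a))) (⟦*⟧ r (lookup a i)))))

    Mem-zero : ∀ {w : M k} → (∀ i → sum (w i) ≡ 0ℤ) → Mem C w
    Mem-zero h = _ , zero-mem , λ i → ∼-trans (∼-reflexive (h i))
      (∼-sym (∼-trans (∼-reflexive (cong ⟦_⟧ (lookup∘tabulate (λ _ → 0F p) i))) (⟦mod⟧ 0)))

    -- Since `B` is p times the inner product, this is integrality of the lattice; it makes the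
    -- coefficients of reflections integers.
    B-divisible : SelfOrthogonal p C → ∀ {z y : M k} → Mem C z → Mem C y → ∃ λ c → B z y ≡ c * + p
    B-divisible so {z} {y} (a , Ca , za) (b , Cb , yb) = 
      let by Q e = ∼-trans (B∼dot z y {a} {b} za yb) (∼-neg (∼-trans (∼-reflexive (cong ⟦_⟧ (so b Cb a Ca))) (⟦mod⟧ 0)))
      in Q , trans e (+-identityˡ _)

-- Injections between finite sets.

suc≢zero : ∀ {n m} {t : Fin (suc n)} → toℕ t ≡ suc m → t ≢ zero
suc≢zero e refl = contradiction e λ ()

injective⇒surjective : ∀ {n} {f : Fin n → Fin n} → (∀ {x y} → f x ≡ f y → x ≡ y) → ∀ y → ∃ λ x → f x ≡ y
injective⇒surjective {suc n} {f} inj y with Fin.any? (λ x → f x Fin.≟ y)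
... | yes h = h
... | no none = contradiction (λ {x} {x′} e → inj (Fin.punchOut-injective (λ e → none (x , sym e)) (λ e → none (x′ , sym e)) e))
        (Fin.<⇒notInjective {f = λ x → punchOut {i = y} {j = f x} (λ e → none (x , sym e))} (ℕ.n<1+n n))

unassigned : ∀ {n p} (f : Fin n → Fin p) → n ℕ.< p → ∃ λ l → ∀ x → f x ≢ l
unassigned {n} {p} f n<p = let l , h = Fin.¬∀⟶∃¬ p (λ l → ∃ λ x → f x ≡ l) (λ l → Fin.any? (λ x → f x Fin.≟ l)) not-all in
    l , λ x e → h (x , e)
  where
  not-all : ¬ (∀ l → ∃ λ x → f x ≡ l)
  not-all all = Fin.<⇒notInjective {f = λ l → proj₁ (all l)} n<p
    (λ {x} {y} e → trans (sym (proj₂ (all x))) (trans (cong f e) (proj₂ (all y))))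

-- Isometries, reflections, and the roots e_0 - e_t of a block.

module Isometries (q : ℕ) {k : ℕ} {C D : Vec (Fin (suc q)) k → Set} (isC : IsSubspace (suc q) C) (isD : IsSubspace (suc q) D)
  (soD : SelfOrthogonal (suc q) D) where

  open Code q
  module C = Subspace isC
  module D = Subspace isD

  L : (Vec (Fin p) k → Set) → Set
  L C = Σ (M k) (Mem C)

  -- F is not required to be additive: adjointness to G determines it up to the radical of B.
  record Isometry : Set where
    field
      F    : L C → L D
      G    : L D → L C
      adj  : ∀ z y → B (proj₁ (F z)) (proj₁ y) ≡ B (proj₁ z) (proj₁ (G y))
      isoF : ∀ z y → B (proj₁ (F z)) (proj₁ (F y)) ≡ B (proj₁ z) (proj₁ y)
      isoG : ∀ z y → B (proj₁ (G z)) (proj₁ (G y)) ≡ B (proj₁ z) (proj₁ y)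

    image : L C → M k
    image z = proj₁ (F z)

  open Isometry

  -- For a root β the reflection is z - (z, β) β, and (z, β) is the integer `coeff`; subtracting an
  -- integer multiple of β keeps the word in D.
  module Reflection (β : L D) (norm : B (proj₁ β) (proj₁ β) ≡ + 2 * + p) where

    private
      b : M k
      b = proj₁ β

      coeff : ∀ z → Mem D z → ∃ λ c → B z b ≡ c * + p
      coeff z mz = D.B-divisible soD {z} {b} mz (proj₂ β)

    reflection : L D → L D
    reflection (z , mz) = z ⊕ - proj₁ (coeff z mz) · b , D.Mem-combination {z} {b} (- proj₁ (coeff z mz)) mz (proj₂ β)

    private
      B-reflection : ∀ z y → B (proj₁ (reflection z)) y ≡ B (proj₁ z) y + - proj₁ (coeff (proj₁ z) (proj₂ z)) * B b y
      B-reflection (z , mz) y = B-lin z (- proj₁ (coeff z mz)) b y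

      self-adjoint : ∀ z y → B (proj₁ (reflection z)) (proj₁ y) ≡ B (proj₁ z) (proj₁ (reflection y))
      self-adjoint z@(z₀ , mz) y@(y₀ , my) = begin
        B (proj₁ (reflection z)) y₀ ≡⟨ B-reflection z y₀ ⟩
        B z₀ y₀ + - c * B b y₀ ≡⟨ cong (λ x → B z₀ y₀ + - c * x) (trans (B-comm b y₀) ed) ⟩
        B z₀ y₀ + - c * (d * + p) ≡⟨ eq (B z₀ y₀) c d (+ p) ⟩
        B z₀ y₀ + - d * (c * + p) ≡⟨ cong₂ (λ x x′ → x + - d * x′) (B-comm z₀ y₀) (trans (sym ec) (B-comm z₀ b)) ⟩
        B y₀ z₀ + - d * B b z₀ ≡⟨ sym (B-reflection y z₀) ⟩
        B (proj₁ (reflection y)) z₀ ≡⟨ B-comm _ z₀ ⟩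
        B z₀ (proj₁ (reflection y)) ∎
        where
        open ≡-Reasoning
        c d : ℤ
        c = proj₁ (coeff z₀ mz)
        d = proj₁ (coeff y₀ my)
        ec : B z₀ b ≡ c * + p
        ec = proj₂ (coeff z₀ mz)
        ed : B y₀ b ≡ d * + p
        ed = proj₂ (coeff y₀ my)
        eq : ∀ x c d p → x + - c * (d * p) ≡ x + - d * (c * p)
        eq = solve-∀

      isometric : ∀ z y → B (proj₁ (reflection z)) (proj₁ (reflection y)) ≡ B (proj₁ z) (proj₁ y)
      isometric z@(z₀ , mz) y@(y₀ , my) = begin
        B (proj₁ (reflection z)) (proj₁ (reflection y)) ≡⟨ B-reflection z (proj₁ (reflection y)) ⟩
        B z₀ (proj₁ (reflection y)) + - c * B b (proj₁ (reflection y))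
          ≡⟨ cong₂ (λ x x′ → x + - c * x′) (B-linʳ z₀ y₀ (- d) b) (B-linʳ b y₀ (- d) b) ⟩
        (B z₀ y₀ + - d * B z₀ b) + - c * (B b y₀ + - d * B b b)
          ≡⟨ cong₂ (λ x x′ → (B z₀ y₀ + - d * x) + - c * (x′ + - d * B b b)) ec (trans (B-comm b y₀) ed) ⟩
        (B z₀ y₀ + - d * (c * + p)) + - c * (d * + p + - d * B b b) ≡⟨ cong (λ x → (B z₀ y₀ + - d * (c * + p)) + - c * (d * + p + - d * x)) norm ⟩
        (B z₀ y₀ + - d * (c * + p)) + - c * (d * + p + - d * (+ 2 * + p)) ≡⟨ eq (B z₀ y₀) c d (+ p) ⟩
        B z₀ y₀ ∎
        where
        open ≡-Reasoning
        c d : ℤ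
        c = proj₁ (coeff z₀ mz)
        d = proj₁ (coeff y₀ my)
        ec : B z₀ b ≡ c * + p
        ec = proj₂ (coeff z₀ mz)
        ed : B y₀ b ≡ d * + p
        ed = proj₂ (coeff y₀ my)
        eq : ∀ x c d p → (x + - d * (c * p)) + - c * (d * p + - d * (+ 2 * p)) ≡ x
        eq = solve-∀

    -- The reflection is its own adjoint, so the new `G` is the old one preceded by the same
    -- reflection.
    reflect : Isometry → Isometry
    reflect φ = record
      { F = λ z → reflection (F φ z)
      ; G = λ y → G φ (reflection y)
      ; adj = λ z y → trans (self-adjoint (F φ z) y) (adj φ z (reflection y))
      ; isoF = λ z y → trans (isometric (F φ z) (F φ y)) (isoF φ z y)
      ; isoG = λ z y → trans (isoG φ (reflection z) (reflection y)) (isometric z y) }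

    reflect-image : ∀ φ z {c} → B (image φ z) b ≡ c * + p → ∀ y → B (image (reflect φ) z) y ≡ B (image φ z) y + - c * B b y
    reflect-image φ z {c} e y = trans (B-reflection (F φ z) y) (cong (λ x → B (image φ z) y + - x * B b y)
      (*-cancelʳ-≡ (proj₁ (coeff (image φ z) (proj₂ (F φ z)))) c (+ p) (trans (sym (proj₂ (coeff (image φ z) (proj₂ (F φ z))))) e)))

    reflect-fix : ∀ φ z → B (image φ z) b ≡ 0ℤ → ∀ y → B (image (reflect φ) z) y ≡ B (image φ z) y
    reflect-fix φ z e y = trans (reflect-image φ z {0ℤ} (trans e (sym (*-zeroˡ (+ p)))) y) (eq (B (image φ z) y) (B b y))
      where
      eq : ∀ x y → x + - 0ℤ * y ≡ x
      eq = solve-∀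

  root : Fin p → Fin p → Fin p → ℤ
  root a b x = δ a x + -1ℤ * δ b x

  opaque

    sρ : Fin k → ℤ → Fin p → Fin p → M k
    sρ j s a b = emb j (λ x → s * root a b x)

    B-sρ : ∀ j s a b y → B (sρ j s a b) y ≡ s * (+ p * (y j a - y j b))
    B-sρ j s a b y = begin
      B (sρ j s a b) y ≡⟨ trans (B-emb j (λ x → s * root a b x) y) (blk-scale s (root a b) (y j)) ⟩
      s * blk (root a b) (y j) ≡⟨ cong (s *_) (trans (blk-lin -1ℤ (δ a) (δ b) (y j)) (cong₂ (λ u v → u + -1ℤ * v) (blk-δ a (y j)) (blk-δ b (y j)))) ⟩
      s * ((+ p * y j a - sum (y j)) + -1ℤ * (+ p * y j b - sum (y j))) ≡⟨ cong (s *_) (eq (+ p) (y j a) (y j b) (sum (y j))) ⟩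
      s * (+ p * (y j a - y j b)) ∎
      where
      open ≡-Reasoning
      eq : ∀ p a b s → (p * a - s) + -1ℤ * (p * b - s) ≡ p * (a - b)
      eq = solve-∀

    sum-sρ : ∀ j s a b i → sum (sρ j s a b i) ≡ 0ℤ
    sum-sρ j s a b i = trans (sum-scale (δ j i) (λ x → s * root a b x)) (trans (cong (δ j i *_)
      (trans (sum-scale s (root a b)) (cong (s *_) (trans (sum-lin -1ℤ (δ a) (δ b)) (cong₂ (λ u v → u + -1ℤ * v) (sum-δ₁ a) (sum-δ₁ b))))))
      (trans (cong (δ j i *_) (*-zeroʳ s)) (*-zeroʳ (δ j i))))

    sρ-other : ∀ {j i} s a b x → i ≢ j → sρ j s a b i x ≡ 0ℤ
    sρ-other {j} s a b x i≢j rewrite δ-≢ (≢-sym i≢j) = *-zeroˡ (s * root a b x)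

    sρ-first : ∀ j s {a b} → b ≢ a → sρ j s a b j a ≡ s
    sρ-first j s {a} {b} b≢a rewrite δ-refl j | δ-refl a | δ-≢ b≢a = eq s
      where
      eq : ∀ s → 1ℤ * (s * 1ℤ) ≡ s
      eq = solve-∀

    sρ-second : ∀ j s {a b} → a ≢ b → sρ j s a b j b ≡ - s
    sρ-second j s {a} {b} a≢b rewrite δ-refl j | δ-refl b | δ-≢ a≢b = eq s
      where
      eq : ∀ s → 1ℤ * (s * -1ℤ) ≡ - s
      eq = solve-∀

    sρ-neither : ∀ j s {a b x} → a ≢ x → b ≢ x → sρ j s a b j x ≡ 0ℤ
    sρ-neither j s {a} {b} {x} a≢x b≢x rewrite δ-refl j | δ-≢ a≢x | δ-≢ b≢x = eq s
      where
      eq : ∀ s → 1ℤ * (s * 0ℤ) ≡ 0ℤ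
      eq = solve-∀

    -- All these roots share the end e_0, so distinct genuine ones have product 1 within a block.
    -- For t = `zero` this is the zero array, which lets stars be indexed by every t, including the
    -- centre.
    r : Fin k → Fin p → L C
    r i t = sρ i 1ℤ zero t , C.Mem-zero {sρ i 1ℤ zero t} (sum-sρ i 1ℤ zero t)

    B-r : ∀ i t y → B (proj₁ (r i t)) y ≡ + p * (y i zero - y i t)
    B-r i t y = trans (B-sρ i 1ℤ zero t y) (*-identityˡ _)

    r-norm : ∀ i t → t ≢ zero → B (proj₁ (r i t)) (proj₁ (r i t)) ≡ + 2 * + p
    r-norm i t t≢0 = trans (B-r i t (proj₁ (r i t))) (trans (cong₂ (λ a b → + p * (a - b)) (sρ-first i 1ℤ t≢0) (sρ-second i 1ℤ (≢-sym t≢0))) (*-comm (+ p) (+ 2)))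

    r-same : ∀ i {t t′} → t ≢ zero → t′ ≢ zero → t′ ≢ t → B (proj₁ (r i t)) (proj₁ (r i t′)) ≡ + p
    r-same i {t} {t′} t≢0 t′≢0 t′≢t = trans (B-r i t (proj₁ (r i t′)))
      (trans (cong₂ (λ a b → + p * (a - b)) (sρ-first i 1ℤ t′≢0) (sρ-neither i 1ℤ (≢-sym t≢0) t′≢t)) (*-identityʳ (+ p)))

    r-orthogonal : ∀ {i i′} t t′ → i ≢ i′ → B (proj₁ (r i t)) (proj₁ (r i′ t′)) ≡ 0ℤ
    r-orthogonal {i} {i′} t t′ i≢i′ = trans (B-r i t (proj₁ (r i′ t′)))
      (trans (cong₂ (λ a b → + p * (a - b)) (sρ-other 1ℤ zero t′ zero i≢i′) (sρ-other 1ℤ zero t′ t i≢i′)) (*-zeroʳ (+ p)))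

    r-zero : ∀ i y → B (proj₁ (r i zero)) y ≡ 0ℤ
    r-zero i y = trans (B-r i zero y) (trans (cong (+ p *_) (+-inverseʳ (y i zero))) (*-zeroʳ (+ p)))

  -- The image has norm 0 by isometry and so lies in the radical.
  image-zero : ∀ φ i y → B (image φ (r i zero)) y ≡ 0ℤ
  image-zero φ i y = B-const y (B≤0⇒const {z = image φ (r i zero)} (≤-reflexive (trans (isoF φ (r i zero) (r i zero)) (r-zero i _))))

  unsign : ∀ s {d e} → s * (+ p * d) ≡ + p * e → s * d ≡ e
  unsign s {d} {e} h = *-cancelˡ-≡ (+ p) (s * d) e (trans (eq (+ p) s d) h)
    where
    eq : ∀ p s d → p * (s * d) ≡ s * (p * d)
    eq = solve-∀

  unsign-zero : ∀ s {d} → s * s ≡ 1ℤ → s * d ≡ 0ℤ → d ≡ 0ℤ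
  unsign-zero s {d} ss h = trans (sym (*-identityˡ d)) (trans (cong (_* d) (sym ss)) (trans (*-assoc s s d) (trans (cong (s *_) h) (*-zeroʳ s))))

  -- φ maps the root e_0 - e_t of block i to s (e_{σ 0} - e_{σ t}) in block j, for all t ≤ m;
  -- the equality modulo the radical is expressed by pairing with every y.
  record Star (φ : Isometry) (i : Fin k) (m : ℕ) : Set where
    field
      j   : Fin k
      s   : ℤ
      ss  : s * s ≡ 1ℤ
      σ   : Fin p → Fin p
      inj : ∀ {t t′} → toℕ t ℕ.≤ m → toℕ t′ ℕ.≤ m → σ t ≡ σ t′ → t ≡ t′
      img : ∀ t → toℕ t ℕ.≤ m → ∀ y → B (image φ (r i t)) y ≡ s * (+ p * (y j (σ zero) - y j (σ t)))

  module _ {φ : Isometry} {i : Fin k} (st : Star φ i q) where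
    open Star st

    σ-injective : ∀ {t t′} → σ t ≡ σ t′ → t ≡ t′
    σ-injective {t} {t′} = inj (ℕ.s≤s⁻¹ (Fin.toℕ<n t)) (ℕ.s≤s⁻¹ (Fin.toℕ<n t′))

    -- In a complete star `σ` hits every index, so the image roots connect each entry of block `j`
    -- with the one at `σ zero`.
    orthogonal⇒const : ∀ (y : M k) → (∀ t → B (image φ (r i t)) y ≡ 0ℤ) → ∀ a b → y j a ≡ y j b
    orthogonal⇒const y h a b = trans (to0 a) (sym (to0 b))
      where
      to0 : ∀ a → y j a ≡ y j (σ zero)
      to0 a with injective⇒surjective σ-injective a
      ... | t , refl = sym (i-j≡0⇒i≡j _ _ (unsign-zero s ss (unsign s {e = 0ℤ}
          (trans (sym (img t (ℕ.s≤s⁻¹ (Fin.toℕ<n t)) y)) (trans (h t) (sym (*-zeroʳ (+ p))))))))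

    -- This protects finished blocks: the roots of every other source block have images that are
    -- constant on the target `j`.
    image-const : ∀ {i′} → i ≢ i′ → ∀ t a b → image φ (r i′ t) j a ≡ image φ (r i′ t) j b
    image-const {i′} i≢i′ t = orthogonal⇒const (image φ (r i′ t)) (λ t′ → trans (isoF φ (r i t′) (r i′ t)) (r-orthogonal t′ t i≢i′))

  star-transport : ∀ {φ φ′ i m} (st : Star φ i m) → (∀ t → toℕ t ℕ.≤ m → ∀ y → B (image φ′ (r i t)) y ≡ B (image φ (r i t)) y) → Star φ′ i m
  star-transport st h = record { Star st ; img = λ t le y → trans (h t le y) (Star.img st t le y) }

  Processed : Isometry → ℕ → Set
  Processed φ n = ∀ i → toℕ i ℕ.< n → Star φ i q

  Next : Fin k → ℕ → Set
  Next i m = Σ Isometry λ φ → Processed φ (toℕ i) × Star φ i m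

-- Moving the image roots into place by reflections.

module Alignment (q : ℕ) {k : ℕ} {C D : Vec (Fin (suc q)) k → Set} (isC : IsSubspace (suc q) C) (isD : IsSubspace (suc q) D)
  (soD : SelfOrthogonal (suc q) D) (prime : Prime (suc q)) (odd : ¬ 2 ∣ suc q) where

  open Code q
  open Isometries q isC isD soD
  open Isometry

  module GoodStep (φ : Isometry) {i : Fin k} (pr : Processed φ (toℕ i)) {m : ℕ} (st : Star φ i m)
    {t* : Fin p} (t*≡ : toℕ t* ≡ suc m) {l : Fin p} (fresh : ∀ t → toℕ t ℕ.≤ m → Star.σ st t ≢ l)
    (h : 1ℤ ≤ Star.s st * (image φ (r i t*) (Star.j st) (Star.σ st zero) - image φ (r i t*) (Star.j st) l)) where

    open Star st
    open ≡-Reasoning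

    private
      u τ : M k
      u = image φ (r i t*)
      τ = sρ j s (σ zero) l

      d : ℤ
      d = s * (u j (σ zero) - u j l)

      σ0≢l : σ zero ≢ l
      σ0≢l = fresh zero ℕ.z≤n

      t*≢0 : t* ≢ zero
      t*≢0 = suc≢zero t*≡

      ≤m⇒≢t* : ∀ {t} → toℕ t ℕ.≤ m → t ≢ t*
      ≤m⇒≢t* le refl = contradiction (subst (ℕ._≤ m) t*≡ le) ℕ.1+n≰n

      uu : B u u ≡ + 2 * + p
      uu = trans (isoF φ (r i t*) (r i t*)) (r-norm i t* t*≢0)

      τu : B τ u ≡ d * + p
      τu = trans (B-sρ j s (σ zero) l u) (eq s (+ p) (u j (σ zero) - u j l))
        where
        eq : ∀ s p x → s * (p * x) ≡ s * x * p
        eq = solve-∀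

      ττ : B τ τ ≡ + 2 * + p
      ττ = begin
        B τ τ ≡⟨ B-sρ j s (σ zero) l τ ⟩
        s * (+ p * (τ j (σ zero) - τ j l)) ≡⟨ cong₂ (λ a b → s * (+ p * (a - b))) (sρ-first j s (≢-sym σ0≢l)) (sρ-second j s σ0≢l) ⟩
        s * (+ p * (s - - s)) ≡⟨ eq s (+ p) ⟩
        + 2 * (s * s) * + p ≡⟨ cong (λ a → + 2 * a * + p) ss ⟩
        + 2 * + p ∎
        where
        eq : ∀ s p → s * (p * (s - - s)) ≡ + 2 * (s * s) * p
        eq = solve-∀

      β : M k
      β = u ⊕ -1ℤ · τ

      uβ : B u β ≡ (+ 2 - d) * + p
      uβ = trans (B-linʳ u u -1ℤ τ) (trans (cong₂ (λ a b → a + -1ℤ * b) uu (trans (B-comm u τ) τu)) (eq d (+ p)))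
        where
        eq : ∀ d p → + 2 * p + -1ℤ * (d * p) ≡ (+ 2 - d) * p
        eq = solve-∀

      ββ : B β β ≡ (+ 4 - + 2 * d) * + p
      ββ = begin
        B β β ≡⟨ B-lin u -1ℤ τ β ⟩
        B u β + -1ℤ * B τ β ≡⟨ cong₂ (λ a b → a + -1ℤ * b) uβ (trans (B-linʳ τ u -1ℤ τ) (cong₂ (λ a b → a + -1ℤ * b) τu ττ)) ⟩
        (+ 2 - d) * + p + -1ℤ * (d * + p + -1ℤ * (+ 2 * + p)) ≡⟨ eq d (+ p) ⟩
        (+ 4 - + 2 * d) * + p ∎
        where
        eq : ∀ d p → (+ 2 - d) * p + -1ℤ * (d * p + -1ℤ * (+ 2 * p)) ≡ (+ 4 - + 2 * d) * p
        eq = solve-∀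

      σ′ : Fin p → Fin p
      σ′ t = if does (t Fin.≟ t*) then l else σ t

      σ′-t* : σ′ t* ≡ l
      σ′-t* = cong (λ b → if b then l else σ t*) (dec-true (t* Fin.≟ t*) refl)

      σ′-old : ∀ {t} → t ≢ t* → σ′ t ≡ σ t
      σ′-old {t} ne = cong (λ b → if b then l else σ t) (dec-false (t Fin.≟ t*) ne)

      old : ∀ {t} → toℕ t ℕ.≤ suc m → t ≢ t* → toℕ t ℕ.≤ m
      old le ne with ℕ.m≤n⇒m<n∨m≡n le
      ... | inj₁ lt = ℕ.s≤s⁻¹ lt
      ... | inj₂ e = contradiction (Fin.toℕ-injective (trans e (sym t*≡))) ne

      extend : ∀ {φ′} → (∀ t → toℕ t ℕ.≤ m → ∀ y → B (image φ′ (r i t)) y ≡ B (image φ (r i t)) y) →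
        (∀ y → B (image φ′ (r i t*)) y ≡ B τ y) → Star φ′ i (suc m)
      extend {φ′} fix new = record { j = j ; s = s ; ss = ss ; σ = σ′ ; inj = inj′ ; img = img′ }
        where
        inj′ : ∀ {t t′} → toℕ t ℕ.≤ suc m → toℕ t′ ℕ.≤ suc m → σ′ t ≡ σ′ t′ → t ≡ t′
        inj′ {t} {t′} le le′ e = cases (t Fin.≟ t*) (t′ Fin.≟ t*)
          where
          cases : Dec (t ≡ t*) → Dec (t′ ≡ t*) → t ≡ t′
          cases (yes e₁) (yes e₂) = trans e₁ (sym e₂)
          cases (yes refl) (no ne) = contradiction (trans (sym (σ′-old ne)) (trans (sym e) σ′-t*)) (fresh t′ (old le′ ne))
          cases (no ne) (yes refl) = contradiction (trans (sym (σ′-old ne)) (trans e σ′-t*)) (fresh t (old le ne))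
          cases (no ne) (no ne′) = inj (old le ne) (old le′ ne′) (trans (sym (σ′-old ne)) (trans e (σ′-old ne′)))
        img′ : ∀ t → toℕ t ℕ.≤ suc m → ∀ y → B (image φ′ (r i t)) y ≡ s * (+ p * (y j (σ′ zero) - y j (σ′ t)))
        img′ t le y = cases (t Fin.≟ t*)
          where
          cases : Dec (t ≡ t*) → B (image φ′ (r i t)) y ≡ s * (+ p * (y j (σ′ zero) - y j (σ′ t)))
          cases (yes refl) = trans (new y) (trans (B-sρ j s (σ zero) l y)
            (cong₂ (λ a b → s * (+ p * (y j a - y j b))) (sym (σ′-old (≢-sym t*≢0))) (sym σ′-t*)))
          cases (no ne) = trans (fix t (old le ne) y) (trans (img t (old le ne) y)
            (cong₂ (λ a b → s * (+ p * (y j a - y j b))) (sym (σ′-old (≢-sym t*≢0))) (sym (σ′-old ne))))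

      -- For d ≥ 2 the norm 4 - 2d of u - τ is not positive, so u and τ agree modulo the radical and
      -- φ itself can be kept.
      by-equality : B β β ≤ 0ℤ → Next i (suc m)
      by-equality le = φ , pr , extend {φ} (λ t _ y → refl) (λ y → 
        i-j≡0⇒i≡j (B u y) (B τ y) (trans (eq (B u y) (B τ y)) (trans (sym (B-lin u -1ℤ τ y)) (B-const y (B≤0⇒const {z = β} le)))))
        where
        eq : ∀ a b → a - b ≡ a + -1ℤ * b
        eq = solve-∀

      by-reflection : d ≡ 1ℤ → Next i (suc m)
      by-reflection d≡1 = φ′ , pr′ , extend {φ′} fix-i new
        where
        βD : L D
        βD = β , D.Mem-combination {u} {τ} -1ℤ (proj₂ (F φ (r i t*))) (D.Mem-zero {τ} (sum-sρ j s (σ zero) l))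
        open Reflection βD (trans ββ (cong (λ a → (+ 4 - + 2 * a) * + p) d≡1))
        φ′ : Isometry
        φ′ = reflect φ
        Bβ : ∀ x → B (image φ x) β ≡ B (image φ x) u + -1ℤ * B (image φ x) τ
        Bβ x = B-linʳ (image φ x) u -1ℤ τ
        pr′ : Processed φ′ (toℕ i)
        pr′ i′ lt = star-transport (pr i′ lt) (λ t le → reflect-fix φ (r i′ t) (trans (Bβ (r i′ t))
            (cong₂ (λ a b → a + -1ℤ * b) (trans (isoF φ (r i′ t) (r i t*)) (r-orthogonal t t* i′≢i))
              (trans (Star.img (pr i′ lt) t le τ) (trans (cong₂ (λ a b → Star.s (pr i′ lt) * (+ p * (a - b)))
                (sρ-other s (σ zero) l _ j′≢j) (sρ-other s (σ zero) l _ j′≢j)) (trans (cong (Star.s (pr i′ lt) *_) (*-zeroʳ (+ p))) (*-zeroʳ (Star.s (pr i′ lt)))))))))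
          where
          i′≢i : i′ ≢ i
          i′≢i refl = ℕ.<-irrefl refl lt
          -- On a target block already in use u would be constant, giving d = 0 and contradicting d
          -- ≥ 1. So new stars land on new blocks.
          j′≢j : Star.j (pr i′ lt) ≢ j
          j′≢j e = contradiction (subst (1ℤ ≤_) d≡0 h) (<⇒≱ (+<+ (ℕ.s≤s ℕ.z≤n)))
            where
            d≡0 : d ≡ 0ℤ
            d≡0 = trans (cong (λ a → s * (a - u j l)) (subst (λ j → u j (σ zero) ≡ u j l) e (image-const (pr i′ lt) i′≢i t* (σ zero) l)))
              (trans (cong (s *_) (+-inverseʳ (u j l))) (*-zeroʳ s))
        fix-i : ∀ t → toℕ t ℕ.≤ m → ∀ y → B (image φ′ (r i t)) y ≡ B (image φ (r i t)) y
        fix-i t le = cases (t Fin.≟ zero)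
          where
          eq : ∀ p → p + -1ℤ * p ≡ 0ℤ
          eq = solve-∀
          eq′ : ∀ s p → s * (p * (s - 0ℤ)) ≡ s * s * p
          eq′ = solve-∀
          -- The old root and τ share only the end at `σ zero`; their product 1 cancels the product
          -- 1 of the old root with u.
          Bτ : t ≢ zero → B (image φ (r i t)) τ ≡ + p
          Bτ t≢0 = trans (img t le τ) (trans (cong₂ (λ a b → s * (+ p * (a - b))) (sρ-first j s (≢-sym σ0≢l))
            (sρ-neither j s (λ e → t≢0 (sym (inj ℕ.z≤n le e))) (≢-sym (fresh t le))))
            (trans (eq′ s (+ p)) (trans (cong (_* + p) ss) (*-identityˡ (+ p)))))
          cases : Dec (t ≡ zero) → ∀ y → B (image φ′ (r i t)) y ≡ B (image φ (r i t)) y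
          cases (yes refl) = reflect-fix φ (r i zero) (image-zero φ i β)
          cases (no t≢0) = reflect-fix φ (r i t) (trans (Bβ (r i t)) (trans (cong₂ (λ a b → a + -1ℤ * b)
            (trans (isoF φ (r i t) (r i t*)) (r-same i t≢0 t*≢0 (≢-sym (≤m⇒≢t* le)))) (Bτ t≢0)) (eq (+ p))))
        new : ∀ y → B (image φ′ (r i t*)) y ≡ B τ y
        new y = trans (reflect-image φ (r i t*) {1ℤ} (trans uβ (cong (λ a → (+ 2 - a) * + p) d≡1)) y)
          (trans (cong (λ a → B u y + - 1ℤ * a) (B-lin u -1ℤ τ y)) (eq (B u y) (B τ y)))
          where
          eq : ∀ a b → a + - 1ℤ * (a + -1ℤ * b) ≡ b
          eq = solve-∀

    good-step : Next i (suc m)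
    good-step = cases (+ 2 ≤? d)
      where
      eq : ∀ d p → 0ℤ ≡ (+ 4 - + 2 * d) * p + + 2 * (d - + 2) * p
      eq = solve-∀
      cases : Dec (+ 2 ≤ d) → Next i (suc m)
      cases (yes 2≤d) = by-equality (subst (_≤ 0ℤ) (sym ββ)
        (≤-by {y = 0ℤ} (+ 2 * (d - + 2) * + p) (0≤* (0≤* (+≤+ (ℕ.z≤n {2})) (0≤-diff 2≤d)) (+≤+ ℕ.z≤n)) (eq d (+ p))))
      cases (no ¬2≤d) = by-reflection (≤-antisym (i<j⇒i≤pred[j] (≰⇒> ¬2≤d)) h)

  fresh-element : ∀ {m} → suc m ℕ.< p → (σ : Fin p → Fin p) → ∃ λ l → ∀ t → toℕ t ℕ.≤ m → σ t ≢ l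
  fresh-element {m} m<p σ = let l , h = unassigned (λ x → σ (inject≤ x (ℕ.<⇒≤ m<p))) m<p in
    l , λ t le e → h (fromℕ< (ℕ.s≤s le)) (trans (cong σ (Fin.toℕ-injective
      (trans (Fin.toℕ-inject≤ _ (ℕ.<⇒≤ m<p)) (Fin.toℕ-fromℕ< (ℕ.s≤s le))))) e)

  module Step (φ : Isometry) {i : Fin k} (pr : Processed φ (toℕ i)) {m : ℕ} (st : Star φ i (suc m))
    {t* : Fin p} (t*≡ : toℕ t* ≡ suc (suc m)) {l : Fin p} (fresh : ∀ t → toℕ t ℕ.≤ suc m → Star.σ st t ≢ l) where

    open Star st

    private
      u : M k
      u = image φ (r i t*)

      d : ℤ
      d = s * (u j (σ zero) - u j l)

      -- Isometry carries over the product 1 of e_0 - e_t with the new root. Up to the sign `s`, all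
      -- used entries of u except the one at `σ zero` thus lie on one level, exactly 1 below that
      -- entry.
      u-value : ∀ {t} → t ≢ zero → toℕ t ℕ.≤ suc m → s * (u j (σ zero) - u j (σ t)) ≡ 1ℤ
      u-value {t} t≢0 le = unsign s (trans (sym (img t le u)) (trans (isoF φ (r i t) (r i t*))
        (trans (r-same i t≢0 (suc≢zero t*≡) t*≢t) (sym (*-identityʳ (+ p))))))
        where
        t*≢t : t* ≢ t
        t*≢t refl = contradiction (subst (ℕ._≤ suc m) t*≡ le) ℕ.1+n≰n

      eq : ∀ s a b → s * a ≡ s * b + s * (a - b)
      eq = solve-∀

    -- u_l ≥ u_{σ 0} > u_{σ 1}, so that l becomes usable when σ 0 and σ 1 change roles.
    swap-step : {one : Fin p} → toℕ one ≡ 1 → suc m ≡ 1 → d ≤ 0ℤ → Next i (suc (suc m))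
    swap-step {one} one≡ refl d≤0 = GoodStep.good-step φ pr st′ t*≡ fresh′ h
      where
      one≤ : toℕ one ℕ.≤ 1
      one≤ = ℕ.≤-reflexive one≡
      ≡one : ∀ {t} → toℕ (suc t) ℕ.≤ 1 → suc t ≡ one
      ≡one {t} le = Fin.toℕ-injective (trans (ℕ.≤-antisym le (ℕ.s≤s ℕ.z≤n)) (sym one≡))
      σ′ : Fin p → Fin p
      σ′ zero = σ one
      σ′ (suc _) = σ zero
      eq₀ : ∀ s p a → 0ℤ ≡ - s * (p * (a - a))
      eq₀ = solve-∀
      eq₁ : ∀ s p a b → s * (p * (a - b)) ≡ - s * (p * (b - a))
      eq₁ = solve-∀
      eq₂ : ∀ s → - s * - s ≡ s * s
      eq₂ = solve-∀
      inj′ : ∀ {t t′} → toℕ t ℕ.≤ 1 → toℕ t′ ℕ.≤ 1 → σ′ t ≡ σ′ t′ → t ≡ t′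
      inj′ {zero} {zero} _ _ _ = refl
      inj′ {zero} {suc t′} _ _ e = contradiction (inj one≤ ℕ.z≤n e) (suc≢zero one≡)
      inj′ {suc t} {zero} _ _ e = contradiction (inj one≤ ℕ.z≤n (sym e)) (suc≢zero one≡)
      inj′ {suc t} {suc t′} le le′ _ = trans (≡one le) (sym (≡one le′))
      img′ : ∀ t → toℕ t ℕ.≤ 1 → ∀ y → B (image φ (r i t)) y ≡ - s * (+ p * (y j (σ′ zero) - y j (σ′ t)))
      img′ zero _ y = trans (image-zero φ i y) (eq₀ s (+ p) (y j (σ one)))
      img′ (suc t) le y = trans (img (suc t) le y) (trans (cong (λ t → s * (+ p * (y j (σ zero) - y j (σ t)))) (≡one le))
        (eq₁ s (+ p) (y j (σ zero)) (y j (σ one))))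
      st′ : Star φ i 1
      st′ = record { j = j ; s = - s ; ss = trans (eq₂ s) ss ; σ = σ′ ; inj = inj′ ; img = img′ }
      fresh′ : ∀ t → toℕ t ℕ.≤ 1 → σ′ t ≢ l
      fresh′ zero _ = fresh one one≤
      fresh′ (suc t) _ = fresh zero ℕ.z≤n
      eq₃ : ∀ s a b l → - s * (b - l) ≡ s * (a - b) + (0ℤ - s * (a - l))
      eq₃ = solve-∀
      h : 1ℤ ≤ - s * (u j (σ one) - u j l)
      h = ≤-by (0ℤ - d) (0≤-diff d≤0) (trans (eq₃ s (u j (σ zero)) (u j (σ one)) (u j l)) (cong (_+ (0ℤ - d)) (u-value (suc≢zero one≡) one≤)))

    -- The high entries are those at `σ zero` and `l`, the equal low ones those at `σ one` and
    -- `σ two`. Tightness gives (u, τ) = 0, while (β, τ) = -1, so reflecting in β raises the product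
    -- to 1 and `GoodStep` applies. The earlier roots stay fixed: in block `j` the root β is
    -- supported at the fresh index `l`, and on finished target blocks u is constant, hence β is
    -- zero.
    module EscapeStep {one two : Fin p} (one≡ : toℕ one ≡ 1) (two≡ : toℕ two ≡ 2) (2≤m : 2 ℕ.≤ suc m) (d≤0 : d ≤ 0ℤ) where

      private
        one≤ : toℕ one ℕ.≤ suc m
        one≤ = subst (ℕ._≤ suc m) (sym one≡) (ℕ.s≤s ℕ.z≤n)

        two≤ : toℕ two ℕ.≤ suc m
        two≤ = subst (ℕ._≤ suc m) (sym two≡) 2≤m

        σ1≢σ2 : σ one ≢ σ two
        σ1≢σ2 e = contradiction (trans (sym one≡) (trans (cong toℕ (inj one≤ two≤ e)) two≡)) λ ()

        a≡b+1 : ∀ {t} → t ≢ zero → toℕ t ℕ.≤ suc m → s * u j (σ zero) ≡ s * u j (σ t) + 1ℤ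
        a≡b+1 {t} t≢0 le = trans (eq s (u j (σ zero)) (u j (σ t))) (cong (_+_ (s * u j (σ t))) (u-value t≢0 le))

        ea : s * u j (σ zero) ≡ s * u j (σ one) + 1ℤ
        ea = a≡b+1 (suc≢zero one≡) one≤

        eb : s * u j (σ two) ≡ s * u j (σ one)
        eb = trans (b≡a-1 (suc≢zero two≡) two≤) (sym (b≡a-1 (suc≢zero one≡) one≤))
          where
          eq′ : ∀ s a b → s * b ≡ s * a - s * (a - b)
          eq′ = solve-∀
          b≡a-1 : ∀ {t} → t ≢ zero → toℕ t ℕ.≤ suc m → s * u j (σ t) ≡ s * u j (σ zero) - 1ℤ
          b≡a-1 {t} t≢0 le = trans (eq′ s (u j (σ zero)) (u j (σ t))) (cong (λ x → s * u j (σ zero) - x) (u-value t≢0 le))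

        el : s * u j (σ one) + 1ℤ ≤ s * u j l
        el = subst (_≤ s * u j l) ea (≤-by (0ℤ - d) (0≤-diff d≤0) (eq′ s (u j l) (u j (σ zero))))
          where
          eq′ : ∀ s l a → s * l ≡ s * a + (0ℤ - s * (a - l))
          eq′ = solve-∀

        esc : Escape u j s l × s * u j l ≡ s * u j (σ zero)
        esc = escape odd u (trans (isoF φ (r i t*) (r i t*)) (r-norm i t* (suc≢zero t*≡))) j ss
          (fresh zero ℕ.z≤n) σ1≢σ2 eb ea el prime

        module E = Escape (proj₁ esc)

        β : M k
        β = E.β

        βD : L D
        βD = β , D.Mem-multiple {u} {β} E.N (proj₂ (F φ (r i t*))) (λ i → by (proj₁ (E.sums i)) (proj₂ (E.sums i)))

        open Reflection βD E.norm

        φ′ : Isometry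
        φ′ = reflect φ

        vanish : ∀ s a b → a ≡ 0ℤ → b ≡ 0ℤ → s * (+ p * (a - b)) ≡ 0ℤ
        vanish s a b refl refl = trans (cong (s *_) (*-zeroʳ (+ p))) (*-zeroʳ s)

        pr′ : Processed φ′ (toℕ i)
        pr′ i′ lt = star-transport (pr i′ lt) (λ t le → reflect-fix φ (r i′ t)
          (trans (Star.img (pr i′ lt) t le β) (vanish (Star.s (pr i′ lt)) _ _ (zero-block _) (zero-block _))))
          where
          zero-block : ∀ x → β (Star.j (pr i′ lt)) x ≡ 0ℤ
          zero-block = E.βconst _ (image-const (pr i′ lt) {i} (λ { refl → ℕ.<-irrefl refl lt }) t*)

        βj≡0 : ∀ t → toℕ t ℕ.≤ suc m → β j (σ t) ≡ 0ℤ
        βj≡0 t le = trans (E.βj (σ t)) (trans (cong (s *_) (δ-≢ (≢-sym (fresh t le)))) (*-zeroʳ s))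

        st′ : Star φ′ i (suc m)
        st′ = star-transport st (λ t le → reflect-fix φ (r i t) (trans (img t le β) (vanish s _ _ (βj≡0 zero ℕ.z≤n) (βj≡0 t le))))

        u′ τ : M k
        u′ = image φ′ (r i t*)
        τ = sρ j s (σ zero) l

        τu : B τ u ≡ 0ℤ
        τu = trans (B-sρ j s (σ zero) l u) (trans (eq₁ s (+ p) (u j (σ zero)) (u j l))
          (trans (cong (λ x → + p * (s * u j (σ zero) - x)) (proj₂ esc)) (trans (cong (+ p *_) (+-inverseʳ (s * u j (σ zero)))) (*-zeroʳ (+ p)))))
          where
          eq₁ : ∀ s p a b → s * (p * (a - b)) ≡ p * (s * a - s * b)
          eq₁ = solve-∀

        τβ : B τ β ≡ - + p
        τβ = trans (B-sρ j s (σ zero) l β) (trans (cong₂ (λ a b → s * (+ p * (a - b))) (βj≡0 zero ℕ.z≤n) (trans (E.βj l) (cong (s *_) (δ-refl l))))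
          (trans (eq₁ s (+ p)) (trans (cong (λ x → - (x * + p)) ss) (cong -_ (*-identityˡ (+ p))))))
          where
          eq₁ : ∀ s p → s * (p * (0ℤ - s * 1ℤ)) ≡ - (s * s * p)
          eq₁ = solve-∀

        d′ : s * (u′ j (σ zero) - u′ j l) ≡ 1ℤ
        d′ = unsign s (trans (sym (B-sρ j s (σ zero) l u′)) (trans (B-comm τ u′)
          (trans (reflect-image φ (r i t*) {1ℤ} (trans E.zβ (sym (*-identityˡ (+ p)))) τ)
            (trans (cong₂ (λ a b → a + - 1ℤ * b) (trans (B-comm u τ) τu) (trans (B-comm β τ) τβ)) (eq₁ (+ p))))))
          where
          eq₁ : ∀ p → 0ℤ + - 1ℤ * - p ≡ p * 1ℤ
          eq₁ = solve-∀

      escape-step : Next i (suc (suc m))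
      escape-step = GoodStep.good-step φ′ pr′ st′ t*≡ fresh (≤-reflexive (sym d′))

    step : Next i (suc (suc m))
    step = cases (1ℤ ≤? d)
      where
      2+m<p : suc (suc m) ℕ.< p
      2+m<p = subst (ℕ._< p) t*≡ (Fin.toℕ<n t*)
      element : ∀ n → n ℕ.≤ suc (suc m) → ∃ λ (t : Fin p) → toℕ t ≡ n
      element n le = fromℕ< (ℕ.≤-<-trans le 2+m<p) , Fin.toℕ-fromℕ< (ℕ.≤-<-trans le 2+m<p)
      one = element 1 (ℕ.s≤s ℕ.z≤n)
      two = element 2 (ℕ.s≤s (ℕ.s≤s ℕ.z≤n))
      bad : d ≤ 0ℤ → 2 ℕ.≤ suc m ⊎ suc m ≡ 1 → Next i (suc (suc m))
      bad d≤0 (inj₁ 2≤m) = EscapeStep.escape-step (proj₂ one) (proj₂ two) 2≤m d≤0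
      bad d≤0 (inj₂ m≡1) = swap-step (proj₂ one) m≡1 d≤0
      cases : Dec (1ℤ ≤ d) → Next i (suc (suc m))
      cases (yes h) = GoodStep.good-step φ pr st t*≡ fresh h
      cases (no ¬h) = bad (i<j⇒i≤pred[j] (≰⇒> ¬h)) (Sum.map₂ sym (ℕ.m≤n⇒m<n∨m≡n (ℕ.s≤s (ℕ.z≤n {m}))))

  -- The image of the first root has norm 2 and so is non-constant on some block. Any pair with u_b
  -- < u_a there has (u, e_a - e_b) ≥ 1, and the star consisting of the centre `a` alone is ready
  -- for `GoodStep`.
  start : ∀ φ {i} → Processed φ (toℕ i) → 1 ℕ.< p → Next i 1
  start φ {i} pr 1<p = cases (Fin.any? (λ j → Fin.any? (λ a → Fin.any? (λ b → u j b <? u j a))))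
    where
    one : Fin p
    one = fromℕ< 1<p
    one≡ : toℕ one ≡ 1
    one≡ = Fin.toℕ-fromℕ< 1<p
    u : M k
    u = image φ (r i one)
    cases : Dec (∃ λ j → ∃ λ a → ∃ λ b → u j b < u j a) → Next i 1
    cases (yes (j , a , b , lt)) = GoodStep.good-step φ pr st one≡ (λ t _ e → <-irrefl (cong (u j) (sym e)) lt)
        (subst (1ℤ ≤_) (sym (*-identityˡ (u j a - u j b))) (1≤-diff lt))
      where
      ≤0⇒≡zero : ∀ {t : Fin p} → toℕ t ℕ.≤ 0 → t ≡ zero
      ≤0⇒≡zero {zero} _ = refl
      st : Star φ i 0
      st = record
        { j = j ; s = 1ℤ ; ss = refl ; σ = λ _ → a
        ; inj = λ le le′ _ → trans (≤0⇒≡zero le) (sym (≤0⇒≡zero le′))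
        ; img = λ t le y → trans (subst (λ t → B (image φ (r i t)) y ≡ 0ℤ) (sym (≤0⇒≡zero le)) (image-zero φ i y)) (eq (+ p) (y j a)) }
        where
        eq : ∀ p a → 0ℤ ≡ 1ℤ * (p * (a - a))
        eq = solve-∀
    cases (no none) = contradiction
      (trans (sym (trans (isoF φ (r i one) (r i one)) (r-norm i one (suc≢zero one≡))))
        (B-const {z = u} u (λ j a b → ≤-antisym (≮⇒≥ (λ lt → none (j , a , b , lt))) (≮⇒≥ (λ lt → none (j , b , a , lt))))))
      λ ()

  component : ∀ φ {i} → Processed φ (toℕ i) → ∀ m → suc m ℕ.< p → Next i (suc m)
  component φ pr zero 1<p = start φ pr 1<p
  component φ {i} pr (suc m) lt = continue (component φ pr m (ℕ.<-trans (ℕ.n<1+n (suc m)) lt))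
    where
    continue : Next i (suc m) → Next i (suc (suc m))
    continue (φ′ , pr′ , st) = let l , fresh = fresh-element lt (Star.σ st) in
      Step.step φ′ pr′ st (Fin.toℕ-fromℕ< lt) fresh

  align : Isometry → ∀ n → n ℕ.≤ k → Σ Isometry λ φ → Processed φ n
  align φ zero _ = φ , λ _ ()
  align φ (suc n) n<k = continue (align φ n (ℕ.<⇒≤ n<k))
    where
    i : Fin k
    i = fromℕ< n<k
    i≡ : toℕ i ≡ n
    i≡ = Fin.toℕ-fromℕ< n<k
    full : ∀ q′ → q ≡ suc q′ → ∀ φ → Processed φ n → Next i q
    full q′ refl φ pr = component φ (subst (Processed φ) (sym i≡) pr) q′ (ℕ.n<1+n (suc q′))
    last : ∀ {i′ : Fin k} → toℕ i′ ≡ n → i ≡ i′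
    last e = Fin.toℕ-injective (trans i≡ (sym e))
    finish : Next i q → Σ Isometry λ φ → Processed φ (suc n)
    finish (φ′ , pr′ , st) = φ′ , λ i′ lt → cases i′ (ℕ.m≤n⇒m<n∨m≡n (ℕ.s≤s⁻¹ lt))
      where
      cases : ∀ i′ → toℕ i′ ℕ.< n ⊎ toℕ i′ ≡ n → Star φ′ i′ q
      cases i′ (inj₁ lt) = pr′ i′ (subst (toℕ i′ ℕ.<_) (sym i≡) lt)
      cases i′ (inj₂ e) = subst (λ i → Star φ′ i q) (last e) st
    q-positive : ∃ λ q′ → q ≡ suc q′
    q-positive = ℕ.pred q , sym (ℕ.suc-pred q {{ℕ.>-nonZero (ℕ.s≤s⁻¹ (ℕ.nonTrivial⇒n>1 (suc q) {{prime⇒nonTrivial prime}}))}})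
    continue : (Σ Isometry λ φ → Processed φ n) → Σ Isometry λ φ → Processed φ (suc n)
    continue (φ′ , pr) = finish (full (proj₁ q-positive) (proj₂ q-positive) φ′ pr)

-- Reading off the signed permutation of codes.

injective⇒permutation : ∀ {n} (f : Fin n → Fin n) → (∀ {x y} → f x ≡ f y → x ≡ y) → Permutation′ n
injective⇒permutation f inj = permutation f (λ y → proj₁ (surj y)) (λ y → proj₂ (surj y)) (λ x → inj (proj₂ (surj (f x))))
  where
  surj = injective⇒surjective inj

sign-cases : ∀ s → s * s ≡ 1ℤ → s ≡ 1ℤ ⊎ s ≡ -1ℤ
sign-cases s ss = Sum.map (i-j≡0⇒i≡j s 1ℤ) (i-j≡0⇒i≡j s -1ℤ)
  (i*j≡0⇒i≡0∨j≡0 (s - 1ℤ) {s - -1ℤ} (trans (eq s) (cong (_- 1ℤ) ss)))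
  where
  eq : ∀ s → (s - 1ℤ) * (s - -1ℤ) ≡ s * s - 1ℤ
  eq = solve-∀

lookup-ext : ∀ {A : Set} {n} (x : Vec A n) {f : Fin n → A} → (∀ i → lookup x i ≡ f i) → x ≡ tabulate f
lookup-ext x h = trans (sym (tabulate∘lookup x)) (tabulate-cong h)

module Extraction (q : ℕ) {k : ℕ} {C D : Vec (Fin (suc q)) k → Set} (isC : IsSubspace (suc q) C) (isD : IsSubspace (suc q) D)
  (soD : SelfOrthogonal (suc q) D) (1≤q : 1 ℕ.≤ q) where

  open Code q
  open Isometries q isC isD soD
  open Isometry

  -- Represents the point whose i-th component is x_i ε₁.
  lift : Vec (Fin p) k → M k
  lift x i t = δ zero t * ⟦ lookup x i ⟧

  lift-word : ∀ x → Word (lift x) x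
  lift-word x i = ∼-reflexive (sum-δ {p} zero (λ _ → ⟦ lookup x i ⟧))

  module _ (φ : Isometry) (stars : ∀ i → Star φ i q) where

    private
      module St i = Star (stars i)

    -- If two source blocks shared a target, a root of one would have an image constant on that
    -- block, hence orthogonal to itself although its norm is 2.
    j-injective : ∀ {i i′} → St.j i ≡ St.j i′ → i ≡ i′
    j-injective {i} {i′} e = cases (i Fin.≟ i′)
      where
      one : Fin p
      one = fromℕ< (ℕ.s≤s 1≤q)
      u : M k
      u = image φ (r i′ one)
      cases : Dec (i ≡ i′) → i ≡ i′
      cases (yes i≡i′) = i≡i′
      cases (no i≢i′) = contradiction
        (trans (sym (r-norm i′ one (suc≢zero (Fin.toℕ-fromℕ< (ℕ.s≤s 1≤q)))))
          (trans (sym (isoF φ (r i′ one) (r i′ one)))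
            (trans (St.img i′ one (ℕ.s≤s⁻¹ (Fin.toℕ<n one)) u)
              (trans (cong (λ x → St.s i′ * (+ p * (x - u (St.j i′) (St.σ i′ one)))) const)
                (eq (St.s i′) (+ p) (u (St.j i′) (St.σ i′ one)))))))
        λ ()
        where
        const : u (St.j i′) (St.σ i′ zero) ≡ u (St.j i′) (St.σ i′ one)
        const = subst (λ j → u j (St.σ i′ zero) ≡ u j (St.σ i′ one)) e (image-const (stars i) i≢i′ one _ _)
        eq : ∀ s p a → s * (p * (a - a)) ≡ 0ℤ
        eq = solve-∀

    -- Products with the images of e_0 - e_t determine all differences in the target block. There
    -- the image is s z_i, permuted by `σ`, plus a constant; over p entries this constant
    -- contributes a multiple of p and is the quotient given to `by`.
    block-sum : ∀ z i → sum (image φ z (St.j i)) ∼ St.s i * sum (proj₁ z i)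
    block-sum z i = by (y (σ zero) - s * x zero) (begin
      sum y ≡⟨ sym (*-identityˡ (sum y)) ⟩
      1ℤ * sum y ≡⟨ cong (_* sum y) (sym ss) ⟩
      s * s * sum y ≡⟨ eq₁ s (y (σ zero)) (+ p) (sum y) ⟩
      s * s * (y (σ zero) * + p) - s * (s * (+ p * y (σ zero) - sum y)) ≡⟨ cong₂ (λ a b → a * (y (σ zero) * + p) - s * b) ss sums ⟩
      1ℤ * (y (σ zero) * + p) - s * (+ p * x zero - sum x) ≡⟨ eq₂ s (y (σ zero)) (x zero) (+ p) (sum x) ⟩
      s * sum x + (y (σ zero) - s * x zero) * + p ∎)
      where
      open ≡-Reasoning
      open Star (stars i)
      y x : Fin p → ℤ
      y = image φ z j
      x = proj₁ z i
      eq₁ : ∀ s y p S → s * s * S ≡ s * s * (y * p) - s * (s * (p * y - S))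
      eq₁ = solve-∀
      eq₂ : ∀ s y x p S → 1ℤ * (y * p) - s * (p * x - S) ≡ s * S + (y - s * x) * p
      eq₂ = solve-∀
      differences : ∀ t → s * (y (σ zero) - y (σ t)) ≡ x zero - x t
      differences t = unsign s (trans (sym (img t (ℕ.s≤s⁻¹ (Fin.toℕ<n t)) (image φ z))) (trans (isoF φ (r i t) z) (B-r i t (proj₁ z))))
      sum-diff : ∀ c (f : Fin p → ℤ) → sum (λ t → c - f t) ≡ + p * c - sum f
      sum-diff c f = trans (sum-cong-≗ (λ t → eq c (f t))) (trans (sum-lin -1ℤ (λ _ → c) f)
        (trans (cong (_+ -1ℤ * sum f) (sum-const p c)) (sym (eq (+ p * c) (sum f)))))
        where
        eq : ∀ a b → a - b ≡ a + -1ℤ * b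
        eq = solve-∀
      sums : s * (+ p * y (σ zero) - sum y) ≡ + p * x zero - sum x
      sums = begin
        s * (+ p * y (σ zero) - sum y) ≡⟨ cong (λ S → s * (+ p * y (σ zero) - S)) (sum-permute y (injective⇒permutation σ (σ-injective (stars i)))) ⟩
        s * (+ p * y (σ zero) - sum (λ t → y (σ t))) ≡⟨ cong (s *_) (sym (sum-diff (y (σ zero)) (λ t → y (σ t)))) ⟩
        s * sum (λ t → y (σ zero) - y (σ t)) ≡⟨ sym (sum-scale s (λ t → y (σ zero) - y (σ t))) ⟩
        sum (λ t → s * (y (σ zero) - y (σ t))) ≡⟨ sum-cong-≗ differences ⟩
        sum (λ t → x zero - x t) ≡⟨ sum-diff (x zero) x ⟩
        + p * x zero - sum x ∎

    source : Fin k → Fin k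
    source c = proj₁ (injective⇒surjective j-injective c)

    j-source : ∀ c → St.j (source c) ≡ c
    j-source c = proj₂ (injective⇒surjective j-injective c)

    π : Permutation′ k
    π = permutation source St.j (λ i → j-injective (j-source (St.j i))) j-source

    signs : Vec Bool k
    signs = tabulate (λ c → does (St.s (source c) ℤ.≟ -1ℤ))

    image-word : ∀ z {a b} → Word (proj₁ z) a → Word (image φ z) b → signedPerm p π signs a ≡ b
    image-word z {a} {b} za yb = sym (lookup-ext b (λ c → ⟦⟧-injective (at c)))
      where
      at : ∀ c → ⟦ lookup b c ⟧ ∼ ⟦ if lookup signs c then -F_ p (lookup a (source c)) else lookup a (source c) ⟧
      at c = ∼-trans (∼-sym (yb c)) (∼-trans (subst (λ c′ → sum (image φ z c′) ∼ s * sum (proj₁ z (source c))) (j-source c) (block-sum z (source c)))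
        (∼-trans (∼-* (∼-reflexive {s} refl) (za (source c))) (subst (λ b → s * ⟦ x ⟧ ∼ ⟦ if b then -F_ p x else x ⟧)
          (sym (lookup∘tabulate (λ c → does (St.s (source c) ℤ.≟ -1ℤ)) c)) (signed (sign-cases s (St.ss (source c)))))))
        where
        s : ℤ
        s = St.s (source c)
        x : Fin p
        x = lookup a (source c)
        signed : s ≡ 1ℤ ⊎ s ≡ -1ℤ → s * ⟦ x ⟧ ∼ ⟦ if does (s ℤ.≟ -1ℤ) then -F_ p x else x ⟧
        signed (inj₁ e) rewrite e = ∼-reflexive (*-identityˡ ⟦ x ⟧)
        signed (inj₂ e) rewrite e = ∼-trans (∼-reflexive (-1*i≡-i ⟦ x ⟧)) (∼-sym (⟦-⟧ x))

    -- Adjointness and the two isometry laws give F(G w) - w norm 0. The difference is thus constant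
    -- on blocks, and constants change entry sums by multiples of p. This yields surjectivity onto
    -- D.
    FG-word : ∀ w {b} → Word (proj₁ w) b → Word (image φ (G φ w)) b
    FG-word w@(w₀ , _) {b} wb i = ∼-trans (by (v i zero) difference) (wb i)
      where
      open ≡-Reasoning
      y v : M k
      y = image φ (G φ w)
      v = y ⊕ -1ℤ · w₀
      yy : B y y ≡ B w₀ w₀
      yy = trans (isoF φ (G φ w) (G φ w)) (isoG φ w w)
      yw : B y w₀ ≡ B w₀ w₀
      yw = trans (adj φ (G φ w) w) (isoG φ w w)
      vv : B v v ≡ 0ℤ
      vv = begin
        B v v ≡⟨ B-lin y -1ℤ w₀ v ⟩
        B y v + -1ℤ * B w₀ v ≡⟨ cong₂ (λ a b → a + -1ℤ * b) (B-linʳ y y -1ℤ w₀) (B-linʳ w₀ y -1ℤ w₀) ⟩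
        (B y y + -1ℤ * B y w₀) + -1ℤ * (B w₀ y + -1ℤ * B w₀ w₀)
          ≡⟨ cong₂ (λ a b → (a + -1ℤ * B y w₀) + -1ℤ * (b + -1ℤ * B w₀ w₀)) yy (trans (B-comm w₀ y) yw) ⟩
        (B w₀ w₀ + -1ℤ * B y w₀) + -1ℤ * (B w₀ w₀ + -1ℤ * B w₀ w₀)
          ≡⟨ cong (λ a → (B w₀ w₀ + -1ℤ * a) + -1ℤ * (B w₀ w₀ + -1ℤ * B w₀ w₀)) yw ⟩
        (B w₀ w₀ + -1ℤ * B w₀ w₀) + -1ℤ * (B w₀ w₀ + -1ℤ * B w₀ w₀) ≡⟨ eq (B w₀ w₀) ⟩
        0ℤ ∎
        where
        eq : ∀ a → (a + -1ℤ * a) + -1ℤ * (a + -1ℤ * a) ≡ 0ℤ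
        eq = solve-∀
      difference : sum (y i) ≡ sum (w₀ i) + v i zero * + p
      difference = begin
        sum (y i) ≡⟨ eq (sum (y i)) (sum (w₀ i)) ⟩
        sum (w₀ i) + (sum (y i) + -1ℤ * sum (w₀ i)) ≡⟨ cong (_+_ (sum (w₀ i))) (sym (sum-lin -1ℤ (y i) (w₀ i))) ⟩
        sum (w₀ i) + sum (v i) ≡⟨ cong (_+_ (sum (w₀ i))) (trans (sum-cong-≗ (λ x → B≤0⇒const {z = v} (≤-reflexive vv) i x zero)) (sum-const p (v i zero))) ⟩
        sum (w₀ i) + + p * v i zero ≡⟨ cong (_+_ (sum (w₀ i))) (*-comm (+ p) (v i zero)) ⟩
        sum (w₀ i) + v i zero * + p ∎
        where
        eq : ∀ a b → a ≡ b + (a + -1ℤ * b)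
        eq = solve-∀

    code-iso : CodeIso p C D
    code-iso = π , signs , forward , backward
      where
      forward : ∀ x → C x → D (signedPerm p π signs x)
      forward x Cx = subst D (sym (image-word z {x} {proj₁ (proj₂ (F φ z))} (lift-word x) (proj₂ (proj₂ (proj₂ (F φ z)))))) (proj₁ (proj₂ (proj₂ (F φ z))))
        where
        z : L C
        z = lift x , x , Cx , lift-word x
      backward : ∀ y → D y → Σ (Vec (Fin p) k) λ x → C x × signedPerm p π signs x ≡ y
      backward y Dy = proj₁ (proj₂ z) , proj₁ (proj₂ (proj₂ z)) ,
          image-word z {proj₁ (proj₂ z)} {y} (proj₂ (proj₂ (proj₂ z))) (FG-word w {y} (lift-word y))
        where
        w : L D
        w = lift y , y , Dy , lift-word y
        z : L C
        z = G φ w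

-- The integers inside the rationals.

infix 8 ι_
ι_ : ℤ → ℚ
ι z = z ℚ./ 1

toℚᵘ-/ : ∀ z n → ℚ.toℚᵘ (z ℚ./ suc n) ℚᵘ.≃ mkℚᵘ z n
toℚᵘ-/ z n = ℚ.toℚᵘ-fromℚᵘ (mkℚᵘ z n)

ι-+ : ∀ a b → ι (a + b) ≡ ι a ℚ.+ ι b
ι-+ a b = ℚ.toℚᵘ-injective (begin
  ℚ.toℚᵘ (ι (a + b))                    ≈⟨ toℚᵘ-/ (a + b) 0 ⟩
  mkℚᵘ (a + b) 0                        ≈⟨ *≡* (cong (_* 1ℤ) (cong₂ _+_ (sym (*-identityʳ a)) (sym (*-identityʳ b)))) ⟩
  mkℚᵘ a 0 ℚᵘ.+ mkℚᵘ b 0                ≈⟨ ℚᵘ.+-cong (toℚᵘ-/ a 0) (toℚᵘ-/ b 0) ⟨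
  ℚ.toℚᵘ (ι a) ℚᵘ.+ ℚ.toℚᵘ (ι b)        ≈⟨ ℚ.toℚᵘ-homo-+ (ι a) (ι b) ⟨
  ℚ.toℚᵘ (ι a ℚ.+ ι b)                  ∎)
  where open import Relation.Binary.Reasoning.Setoid ℚᵘ.≃-setoid

ι-* : ∀ a b → ι (a * b) ≡ ι a ℚ.* ι b
ι-* a b = ℚ.toℚᵘ-injective (begin
  ℚ.toℚᵘ (ι (a * b))                    ≈⟨ toℚᵘ-/ (a * b) 0 ⟩
  mkℚᵘ a 0 ℚᵘ.* mkℚᵘ b 0                ≈⟨ ℚᵘ.*-cong (toℚᵘ-/ a 0) (toℚᵘ-/ b 0) ⟨
  ℚ.toℚᵘ (ι a) ℚᵘ.* ℚ.toℚᵘ (ι b)        ≈⟨ ℚ.toℚᵘ-homo-* (ι a) (ι b) ⟨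
  ℚ.toℚᵘ (ι a ℚ.* ι b)                  ∎)
  where open import Relation.Binary.Reasoning.Setoid ℚᵘ.≃-setoid

ι-injective : ∀ {a b} → ι a ≡ ι b → a ≡ b
ι-injective {a} {b} e = from (ℚᵘ.≃-trans (ℚᵘ.≃-sym (toℚᵘ-/ a 0)) (ℚᵘ.≃-trans (ℚ.toℚᵘ-cong e) (toℚᵘ-/ b 0)))
  where
  from : mkℚᵘ a 0 ℚᵘ.≃ mkℚᵘ b 0 → a ≡ b
  from (*≡* h) = trans (sym (*-identityʳ a)) (trans h (*-identityʳ b))

ι-neg : ∀ a → ι (- a) ≡ ℚ.- ι a
ι-neg a = inverseʳ-unique (ι a) (ι (- a)) (trans (sym (ι-+ a (- a))) (cong ι_ (+-inverseʳ a)))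
  where open import Algebra.Properties.Group ℚ.+-0-group using (inverseʳ-unique)

ι-recip : ∀ n → ι (+ suc n) ℚ.* (+ 1 ℚ./ suc n) ≡ 1ℚ
ι-recip n = ℚ.toℚᵘ-injective (begin
  ℚ.toℚᵘ (ι (+ suc n) ℚ.* (+ 1 ℚ./ suc n))                ≈⟨ ℚ.toℚᵘ-homo-* (ι (+ suc n)) (+ 1 ℚ./ suc n) ⟩
  ℚ.toℚᵘ (ι (+ suc n)) ℚᵘ.* ℚ.toℚᵘ (+ 1 ℚ./ suc n)        ≈⟨ ℚᵘ.*-cong (toℚᵘ-/ (+ suc n) 0) (toℚᵘ-/ (+ 1) n) ⟩
  mkℚᵘ (+ suc n) 0 ℚᵘ.* mkℚᵘ (+ 1) n                      ≈⟨ *≡* (eq (+ suc n)) ⟩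
  ℚᵘ.1ℚᵘ ∎)
  where
  open import Relation.Binary.Reasoning.Setoid ℚᵘ.≃-setoid
  eq : ∀ m → (m * + 1) * + 1 ≡ + 1 * (+ 1 * m)
  eq = solve-∀

sumQ-lookup : ∀ q {n} (v : Vec ℚ n) → sumQ (suc q) v ≡ Σℚ.sum (lookup v)
sumQ-lookup q [] = refl
sumQ-lookup q (x ∷ v) = cong (x ℚ.+_) (sumQ-lookup q v)

ι-sum : ∀ {n} (f : Fin n → ℤ) → ι (sum f) ≡ Σℚ.sum (λ x → ι f x)
ι-sum {zero} f = refl
ι-sum {suc n} f = trans (ι-+ (f zero) (sum (f ∘ suc))) (cong (ι f zero ℚ.+_) (ι-sum (f ∘ suc)))

sumℚ-const : ∀ n c → Σℚ.sum {n} (λ _ → c) ≡ ι (+ n) ℚ.* c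
sumℚ-const zero c = sym (ℚ.*-zeroˡ c)
sumℚ-const (suc n) c = trans (cong (c ℚ.+_) (sumℚ-const n c)) (sym (trans (cong (ℚ._* c) (ι-+ 1ℤ (+ n))) (trans (ℚ.*-distribʳ-+ c 1ℚ (ι (+ n))) (cong (ℚ._+ ι (+ n) ℚ.* c) (ℚ.*-identityˡ c)))))

sumℚ-lin : ∀ {n} c (f g : Fin n → ℚ) → Σℚ.sum (λ x → f x ℚ.+ c ℚ.* g x) ≡ Σℚ.sum f ℚ.+ c ℚ.* Σℚ.sum g
sumℚ-lin c f g = trans (Σℚ.∑-distrib-+ f (λ x → c ℚ.* g x)) (cong (Σℚ.sum f ℚ.+_) (sym (Σℚ.*-distribˡ-sum c g)))

-- Integer arrays as points of the lattice.

module Model (q : ℕ) where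

  open Code q

  c : ℚ
  c = + 1 ℚ./ p

  pc : ι (+ p) ℚ.* c ≡ 1ℚ
  pc = ι-recip q

  toAmb : ∀ {k} → M k → Amb p k
  toAmb z = tabulate (λ i → tabulate (λ x → ι (z i x) ℚ.- ι (sum (z i)) ℚ.* c))

  lookup-toAmb : ∀ {k} (z : M k) i x → lookup (lookup (toAmb z) i) x ≡ ι (z i x) ℚ.- ι (sum (z i)) ℚ.* c
  lookup-toAmb z i x = trans (cong (λ v → lookup v x) (lookup∘tabulate (λ i → tabulate (λ x → ι (z i x) ℚ.- ι (sum (z i)) ℚ.* c)) i))
    (lookup∘tabulate (λ x → ι (z i x) ℚ.- ι (sum (z i)) ℚ.* c) x)

  toAmb-ext : ∀ {k} (z : M k) {v : Amb p k} → (∀ i x → lookup (lookup v i) x ≡ ι (z i x) ℚ.- ι (sum (z i)) ℚ.* c) → v ≡ toAmb z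
  toAmb-ext z {v} h = lookup-ext v (λ i → lookup-ext (lookup v i) (h i))

  inner-sum : ∀ {k} (u v : Amb p k) →
    inner p u v ≡ Σℚ.sum (λ i → Σℚ.sum (λ x → lookup (lookup u i) x ℚ.* lookup (lookup v i) x))
  inner-sum u v = trans (sumQ-lookup q (zipWith pairing u v)) (Σℚ.sum-cong-≗ (λ i → trans (lookup-zipWith pairing i u v)
    (trans (sumQ-lookup q (zipWith ℚ._*_ (lookup u i) (lookup v i))) (Σℚ.sum-cong-≗ (λ x → lookup-zipWith ℚ._*_ x (lookup u i) (lookup v i))))))
    where
    pairing : Vec ℚ p → Vec ℚ p → ℚ
    pairing u v = sumQ p (zipWith ℚ._*_ u v)

  opaque
    unfolding B blk

    -- Subtracting the means produces the product of the entry sums with coefficient (pc)² - 2pc,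
    -- which is -1 because pc = 1.
    inner-block : (z y : Fin p → ℤ) →
      ι (+ p) ℚ.* Σℚ.sum (λ x → (ι (z x) ℚ.- ι (sum z) ℚ.* c) ℚ.* (ι (y x) ℚ.- ι (sum y) ℚ.* c)) ≡ ι (blk z y)
    inner-block z y = begin
      P ℚ.* Σℚ.sum (λ x → (ι (z x) ℚ.- S ℚ.* c) ℚ.* (ι (y x) ℚ.- T ℚ.* c))
        ≡⟨ cong (P ℚ.*_) (Σℚ.sum-cong-≗ (λ x → expand (ι (z x)) (ι (y x)) (S ℚ.* c) (T ℚ.* c))) ⟩
      P ℚ.* Σℚ.sum (λ x → ((ι (z x) ℚ.* ι (y x) ℚ.+ (S ℚ.* c) ℚ.* (T ℚ.* c)) ℚ.+ (ℚ.- (T ℚ.* c)) ℚ.* ι (z x)) ℚ.+ (ℚ.- (S ℚ.* c)) ℚ.* ι (y x))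
        ≡⟨ cong (P ℚ.*_) (trans (sumℚ-lin (ℚ.- (S ℚ.* c)) (λ x → (ι (z x) ℚ.* ι (y x) ℚ.+ (S ℚ.* c) ℚ.* (T ℚ.* c)) ℚ.+ (ℚ.- (T ℚ.* c)) ℚ.* ι (z x)) (λ x → ι (y x)))
             (cong₂ (λ a b → a ℚ.+ (ℚ.- (S ℚ.* c)) ℚ.* b)
               (trans (sumℚ-lin (ℚ.- (T ℚ.* c)) (λ x → ι (z x) ℚ.* ι (y x) ℚ.+ (S ℚ.* c) ℚ.* (T ℚ.* c)) (λ x → ι (z x)))
                 (cong₂ (λ a b → a ℚ.+ (ℚ.- (T ℚ.* c)) ℚ.* b)
                   (trans (Σℚ.∑-distrib-+ (λ x → ι (z x) ℚ.* ι (y x)) (λ _ → (S ℚ.* c) ℚ.* (T ℚ.* c)))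
                     (cong₂ ℚ._+_ (trans (Σℚ.sum-cong-≗ (λ x → sym (ι-* (z x) (y x)))) (sym (ι-sum (λ x → z x * y x)))) (sumℚ-const p _)))
                   (sym (ι-sum z))))
               (sym (ι-sum y)))) ⟩
      P ℚ.* (((Z ℚ.+ P ℚ.* ((S ℚ.* c) ℚ.* (T ℚ.* c))) ℚ.+ (ℚ.- (T ℚ.* c)) ℚ.* S) ℚ.+ (ℚ.- (S ℚ.* c)) ℚ.* T)
        ≡⟨ collect P Z S T c ⟩
      P ℚ.* Z ℚ.+ ((P ℚ.* c) ℚ.* (P ℚ.* c) ℚ.- (P ℚ.* c) ℚ.- (P ℚ.* c)) ℚ.* (S ℚ.* T)
        ≡⟨ cong (λ a → P ℚ.* Z ℚ.+ (a ℚ.* a ℚ.- a ℚ.- a) ℚ.* (S ℚ.* T)) pc ⟩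
      P ℚ.* Z ℚ.+ (1ℚ ℚ.* 1ℚ ℚ.- 1ℚ ℚ.- 1ℚ) ℚ.* (S ℚ.* T)
        ≡⟨ cong (P ℚ.* Z ℚ.+_) (sym (ℚ.neg-distribˡ-* 1ℚ (S ℚ.* T))) ⟩
      P ℚ.* Z ℚ.- 1ℚ ℚ.* (S ℚ.* T)
        ≡⟨ cong₂ (λ a b → a ℚ.- b) (sym (ι-* (+ p) (sum (λ x → z x * y x)))) (trans (ℚ.*-identityˡ (S ℚ.* T)) (sym (ι-* (sum z) (sum y)))) ⟩
      ι (+ p * sum (λ x → z x * y x)) ℚ.- ι (sum z * sum y)
        ≡⟨ cong (ι (+ p * sum (λ x → z x * y x)) ℚ.+_) (sym (ι-neg (sum z * sum y))) ⟩
      ι (+ p * sum (λ x → z x * y x)) ℚ.+ ι (- (sum z * sum y))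
        ≡⟨ sym (ι-+ (+ p * sum (λ x → z x * y x)) (- (sum z * sum y))) ⟩
      ι (blk z y) ∎
      where
      open ≡-Reasoning
      open +-*-Solver using (solve; _:=_; _:+_; _:*_; _:-_; :-_)
      P S T Z : ℚ
      P = ι (+ p)
      S = ι (sum z)
      T = ι (sum y)
      Z = ι (sum (λ x → z x * y x))
      expand : ∀ x y u v → (x ℚ.- u) ℚ.* (y ℚ.- v) ≡ ((x ℚ.* y ℚ.+ u ℚ.* v) ℚ.+ (ℚ.- v) ℚ.* x) ℚ.+ (ℚ.- u) ℚ.* y
      expand = solve 4 (λ x y u v → (x :- u) :* (y :- v) := ((x :* y :+ u :* v) :+ (:- v) :* x) :+ (:- u) :* y) refl
      collect : ∀ P Z S T c → P ℚ.* (((Z ℚ.+ P ℚ.* ((S ℚ.* c) ℚ.* (T ℚ.* c))) ℚ.+ (ℚ.- (T ℚ.* c)) ℚ.* S) ℚ.+ (ℚ.- (S ℚ.* c)) ℚ.* T)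
        ≡ P ℚ.* Z ℚ.+ ((P ℚ.* c) ℚ.* (P ℚ.* c) ℚ.- (P ℚ.* c) ℚ.- (P ℚ.* c)) ℚ.* (S ℚ.* T)
      collect = solve 5 (λ P Z S T c → P :* (((Z :+ P :* ((S :* c) :* (T :* c))) :+ (:- (T :* c)) :* S) :+ (:- (S :* c)) :* T)
        := P :* Z :+ ((P :* c) :* (P :* c) :- (P :* c) :- (P :* c)) :* (S :* T)) refl

    inner-toAmb : ∀ {k} (z y : M k) → ι (+ p) ℚ.* inner p (toAmb z) (toAmb y) ≡ ι (B z y)
    inner-toAmb z y = trans (cong (ι (+ p) ℚ.*_) (trans (inner-sum (toAmb z) (toAmb y))
        (Σℚ.sum-cong-≗ (λ i → Σℚ.sum-cong-≗ (λ x → cong₂ ℚ._*_ (lookup-toAmb z i x) (lookup-toAmb y i x))))))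
      (trans (Σℚ.*-distribˡ-sum (ι (+ p)) (λ i → Σℚ.sum (λ x → (ι (z i x) ℚ.- ι (sum (z i)) ℚ.* c) ℚ.* (ι (y i x) ℚ.- ι (sum (y i)) ℚ.* c))))
        (trans (Σℚ.sum-cong-≗ (λ i → inner-block (z i) (y i))) (sym (ι-sum (λ i → blk (z i) (y i))))))

  inner⇒B : ∀ {k} {z y z′ y′ : M k} → inner p (toAmb z) (toAmb y) ≡ inner p (toAmb z′) (toAmb y′) → B z y ≡ B z′ y′
  inner⇒B {z = z} {y} {z′} {y′} e = ι-injective (trans (sym (inner-toAmb z y)) (trans (cong (ι (+ p) ℚ.*_) e) (inner-toAmb z′ y′)))

  ε₁-value : ∀ x → lookup (ε₁ p) x ≡ ι (δ zero x) ℚ.- c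
  ε₁-value x = trans (lookup∘tabulate (λ x → (if toℕ x ≡ᵇ 0 then 1ℚ else 0ℚ) ℚ.- c) x) (cong (ℚ._- c) (indicator x))
    where
    indicator : ∀ {n} (x : Fin (suc n)) → (if toℕ x ≡ᵇ 0 then 1ℚ else 0ℚ) ≡ ι (δ zero x)
    indicator zero = refl
    indicator (suc x) = refl

  residual : ∀ {k} (v : Amb p k) (a : Vec (Fin p) k) i x →
    lookup (zipWith ℚ._-_ (lookup v i) (map (toQ p (lookup a i) ℚ.*_) (ε₁ p))) x
      ≡ lookup (lookup v i) x ℚ.- ι ⟦ lookup a i ⟧ ℚ.* (ι (δ zero x) ℚ.- c)
  residual v a i x = trans (lookup-zipWith ℚ._-_ x (lookup v i) (map (toQ p (lookup a i) ℚ.*_) (ε₁ p)))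
    (cong (λ e → lookup (lookup v i) x ℚ.- e) (trans (lookup-map x (toQ p (lookup a i) ℚ.*_) (ε₁ p)) (cong (ι ⟦ lookup a i ⟧ ℚ.*_) (ε₁-value x))))

  Mem⇒LA : ∀ {k} {C : Vec (Fin p) k → Set} {z : M k} → Mem C z → LA p C (toAmb z)
  Mem⇒LA {z = z} (a , Ca , za) = a , Ca , λ i → (λ x → W i x , value i x) , (begin
      sumQ p (R i)                   ≡⟨ sumQ-lookup q (R i) ⟩
      Σℚ.sum (lookup (R i))          ≡⟨ Σℚ.sum-cong-≗ (value i) ⟩
      Σℚ.sum (λ x → ι (W i x))       ≡⟨ sym (ι-sum (W i)) ⟩
      ι (sum (W i))                  ≡⟨ cong ι_ (sum-W i) ⟩
      0ℚ                             ∎)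
    where
    open ≡-Reasoning
    open +-*-Solver using (solve; _:=_; _:+_; _:*_; _:-_; :-_)
    R : ∀ i → Vec ℚ p
    R i = zipWith ℚ._-_ (lookup (toAmb z) i) (map (toQ p (lookup a i) ℚ.*_) (ε₁ p))
    A Q : ∀ i → ℤ
    A i = ⟦ lookup a i ⟧
    Q i = quotient (za i)
    -- With entry sum A + Qp, lowering the block by Q makes the sum exactly A; removing A from entry
    -- `zero` then leaves an integer vector of sum 0.
    W : ∀ i → Fin p → ℤ
    W i x = (z i x + - Q i) + - A i * δ zero x
    sum-W : ∀ i → sum (W i) ≡ 0ℤ
    sum-W i = trans (sum-lin (- A i) (λ x → z i x + - Q i) (δ zero))
      (trans (cong₂ (λ u v → u + - A i * v) (trans (∑-distrib-+ (z i) (λ _ → - Q i)) (cong₂ _+_ (equality (za i)) (sum-const p (- Q i)))) (sum-δ₁ {p} zero))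
        (eq (A i) (Q i) (+ p)))
      where
      eq : ∀ A Q p → ((A + Q * p) + p * - Q) + - A * 1ℤ ≡ 0ℤ
      eq = solve-∀
    rearrange : ∀ z A Q P c d → (z ℚ.- (A ℚ.+ Q ℚ.* P) ℚ.* c) ℚ.- A ℚ.* (d ℚ.- c) ≡ (z ℚ.+ ℚ.- (Q ℚ.* (P ℚ.* c))) ℚ.+ (ℚ.- A) ℚ.* d
    rearrange = solve 6 (λ z A Q P c d → (z :- (A :+ Q :* P) :* c) :- A :* (d :- c) := (z :+ :- (Q :* (P :* c))) :+ (:- A) :* d) refl
    value : ∀ i x → lookup (R i) x ≡ ι (W i x)
    value i x = begin
      lookup (R i) x ≡⟨ residual (toAmb z) a i x ⟩
      lookup (lookup (toAmb z) i) x ℚ.- ι A i ℚ.* (ι (δ zero x) ℚ.- c)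
        ≡⟨ cong (λ y → y ℚ.- ι A i ℚ.* (ι (δ zero x) ℚ.- c)) (trans (lookup-toAmb z i x)
             (cong (λ S → ι (z i x) ℚ.- S ℚ.* c) (trans (cong ι_ (equality (za i))) (trans (ι-+ (A i) (Q i * + p)) (cong (ι A i ℚ.+_) (ι-* (Q i) (+ p))))))) ⟩
      (ι (z i x) ℚ.- (ι A i ℚ.+ ι Q i ℚ.* ι (+ p)) ℚ.* c) ℚ.- ι A i ℚ.* (ι (δ zero x) ℚ.- c)
        ≡⟨ rearrange (ι (z i x)) (ι A i) (ι Q i) (ι (+ p)) c (ι (δ zero x)) ⟩
      (ι (z i x) ℚ.+ ℚ.- (ι Q i ℚ.* (ι (+ p) ℚ.* c))) ℚ.+ (ℚ.- ι A i) ℚ.* ι (δ zero x)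
        ≡⟨ cong₂ (λ u v → (ι (z i x) ℚ.+ u) ℚ.+ v ℚ.* ι (δ zero x))
             (trans (cong ℚ.-_ (trans (cong (ι Q i ℚ.*_) pc) (ℚ.*-identityʳ (ι Q i)))) (sym (ι-neg (Q i)))) (sym (ι-neg (A i))) ⟩
      (ι (z i x) ℚ.+ ι (- Q i)) ℚ.+ ι (- A i) ℚ.* ι (δ zero x)
        ≡⟨ cong₂ ℚ._+_ (sym (ι-+ (z i x) (- Q i))) (sym (ι-* (- A i) (δ zero x))) ⟩
      ι (z i x + - Q i) ℚ.+ ι (- A i * δ zero x) ≡⟨ sym (ι-+ (z i x + - Q i) (- A i * δ zero x)) ⟩
      ι (W i x) ∎

  LA⇒Mem : ∀ {k} {C : Vec (Fin p) k → Set} {v : Amb p k} → LA p C v → ∃ λ (z : M k) → Mem C z × v ≡ toAmb z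
  LA⇒Mem {k} {v = v} (a , Ca , h) = z , (a , Ca , λ i → ∼-reflexive (sum-z i)) , toAmb-ext z coordinates
    where
    open ≡-Reasoning
    open +-*-Solver using (solve; _:=_; _:+_; _:*_; _:-_; :-_)
    R : ∀ i → Vec ℚ p
    R i = zipWith ℚ._-_ (lookup v i) (map (toQ p (lookup a i) ℚ.*_) (ε₁ p))
    A : ∀ i → ℤ
    A i = ⟦ lookup a i ⟧
    W : M k
    W i x = proj₁ (proj₁ (h i) x)
    -- Adding A at entry `zero` to the integer vector of sum 0 gives entry sum exactly A, so `toAmb`
    -- subtracts the same A/p as A ε₁ does.
    z : M k
    z i x = W i x + A i * δ zero x
    sum-W : ∀ i → sum (W i) ≡ 0ℤ
    sum-W i = ι-injective (begin
      ι (sum (W i))              ≡⟨ ι-sum (W i) ⟩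
      Σℚ.sum (λ x → ι (W i x))   ≡⟨ Σℚ.sum-cong-≗ (λ x → sym (proj₂ (proj₁ (h i) x))) ⟩
      Σℚ.sum (lookup (R i))      ≡⟨ sym (sumQ-lookup q (R i)) ⟩
      sumQ p (R i)               ≡⟨ proj₂ (h i) ⟩
      ι 0ℤ                       ∎)
    sum-z : ∀ i → sum (z i) ≡ A i
    sum-z i = trans (sum-lin (A i) (W i) (δ zero)) (trans (cong₂ (λ u v → u + A i * v) (sum-W i) (sum-δ₁ {p} zero)) (eq (A i)))
      where
      eq : ∀ A → 0ℤ + A * 1ℤ ≡ A
      eq = solve-∀
    undo : ∀ v A d c → v ≡ ((v ℚ.- A ℚ.* (d ℚ.- c)) ℚ.+ A ℚ.* d) ℚ.- A ℚ.* c
    undo = solve 4 (λ v A d c → v := ((v :- A :* (d :- c)) :+ A :* d) :- A :* c) refl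
    coordinates : ∀ i x → lookup (lookup v i) x ≡ ι (z i x) ℚ.- ι (sum (z i)) ℚ.* c
    coordinates i x = begin
      lookup (lookup v i) x ≡⟨ undo (lookup (lookup v i) x) (ι A i) (ι (δ zero x)) c ⟩
      ((lookup (lookup v i) x ℚ.- ι A i ℚ.* (ι (δ zero x) ℚ.- c)) ℚ.+ ι A i ℚ.* ι (δ zero x)) ℚ.- ι A i ℚ.* c
        ≡⟨ cong₂ (λ u t → (u ℚ.+ t) ℚ.- ι A i ℚ.* c) (trans (sym (residual v a i x)) (proj₂ (proj₁ (h i) x))) (sym (ι-* (A i) (δ zero x))) ⟩
      (ι (W i x) ℚ.+ ι (A i * δ zero x)) ℚ.- ι A i ℚ.* c
        ≡⟨ cong₂ (λ u S → u ℚ.- ι S ℚ.* c) (sym (ι-+ (W i x) (A i * δ zero x))) (sym (sum-z i)) ⟩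
      ι (z i x) ℚ.- ι (sum (z i)) ℚ.* c ∎

  module _ {k} {C D : Vec (Fin p) k → Set} (isC : IsSubspace p C) (isD : IsSubspace p D) (soD : SelfOrthogonal p D) where

    open Isometries q isC isD soD using (Isometry; L)

    -- A lattice point has many arrays, and `F`, `G` select one for each value of f and g.
    -- Adjointness is (f z, y) = (f z, f (g y)) = (z, g y).
    lattice-isometry : LatticeIso p (LA p C) (LA p D) → Isometry
    lattice-isometry (f , g , f∈ , g∈ , gf , fg , _ , inner-f) = record
      { F = F ; G = G
      ; adj = λ z y → inner⇒B {z = proj₁ (F z)} {proj₁ y} {proj₁ z} {proj₁ (G y)}
          (trans (cong₂ (inner p) (F-spec z) (sym (fg (amb {D} y) (LA-D y))))
            (trans (inner-f (amb {C} z) (g (amb {D} y)) (LA-C z) (g∈ (amb {D} y) (LA-D y))) (cong (inner p (amb {C} z)) (sym (G-spec y)))))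
      ; isoF = λ z y → inner⇒B {z = proj₁ (F z)} {proj₁ (F y)} {proj₁ z} {proj₁ y}
          (trans (cong₂ (inner p) (F-spec z) (F-spec y)) (inner-f (amb {C} z) (amb {C} y) (LA-C z) (LA-C y)))
      ; isoG = λ z y → inner⇒B {z = proj₁ (G z)} {proj₁ (G y)} {proj₁ z} {proj₁ y}
          (trans (cong₂ (inner p) (G-spec z) (G-spec y))
            (trans (sym (inner-f (g (amb {D} z)) (g (amb {D} y)) (g∈ (amb {D} z) (LA-D z)) (g∈ (amb {D} y) (LA-D y))))
              (cong₂ (inner p) (fg (amb {D} z) (LA-D z)) (fg (amb {D} y) (LA-D y))))) }
      where
      amb : ∀ {E} → L E → Amb p k
      amb z = toAmb (proj₁ z)
      LA-C : ∀ z → LA p C (amb {C} z)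
      LA-C z = Mem⇒LA {C = C} {proj₁ z} (proj₂ z)
      LA-D : ∀ z → LA p D (amb {D} z)
      LA-D z = Mem⇒LA {C = D} {proj₁ z} (proj₂ z)
      from : ∀ E v → LA p E v → Σ (L E) λ z → amb {E} z ≡ v
      from E v m = let z , mz , e = LA⇒Mem {C = E} {v} m in (z , mz) , sym e
      F : L C → L D
      F z = proj₁ (from D (f (amb {C} z)) (f∈ (amb {C} z) (LA-C z)))
      F-spec : ∀ z → amb {D} (F z) ≡ f (amb {C} z)
      F-spec z = proj₂ (from D (f (amb {C} z)) (f∈ (amb {C} z) (LA-C z)))
      G : L D → L C
      G y = proj₁ (from C (g (amb {D} y)) (g∈ (amb {D} y) (LA-D y)))
      G-spec : ∀ y → amb {C} (G y) ≡ g (amb {D} y)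
      G-spec y = proj₂ (from C (g (amb {D} y)) (g∈ (amb {D} y) (LA-D y)))

-- From code isomorphisms to lattice isomorphisms.

sgn : Bool → ℤ
sgn b = if b then -1ℤ else 1ℤ

sgn² : ∀ b → sgn b * sgn b ≡ 1ℤ
sgn² true = refl
sgn² false = refl

module SignedPermutation (q : ℕ) {k : ℕ} where

  open Code q
  open Model q

  act : (Fin k → Fin k) → (Fin k → Bool) → Amb p k → Amb p k
  act ρ b v = tabulate (λ i → map (ι sgn (b i) ℚ.*_) (lookup v (ρ i)))

  lookup-act : ∀ ρ b v i x → lookup (lookup (act ρ b v) i) x ≡ ι sgn (b i) ℚ.* lookup (lookup v (ρ i)) x
  lookup-act ρ b v i x = trans (cong (λ u → lookup u x) (lookup∘tabulate (λ i → map (ι sgn (b i) ℚ.*_) (lookup v (ρ i))) i))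
    (lookup-map x (ι sgn (b i) ℚ.*_) (lookup v (ρ i)))

  amb-ext : ∀ {u v : Amb p k} → (∀ i x → lookup (lookup u i) x ≡ lookup (lookup v i) x) → u ≡ v
  amb-ext {u} {v} h = trans (lookup-ext u (λ i → trans (lookup-ext (lookup u i) (h i)) (tabulate∘lookup (lookup v i)))) (tabulate∘lookup v)

  ι-sgn² : ∀ b x → ι sgn b ℚ.* (ι sgn b ℚ.* x) ≡ x
  ι-sgn² b x = trans (sym (ℚ.*-assoc (ι sgn b) (ι sgn b) x)) (trans (cong (ℚ._* x) (trans (sym (ι-* (sgn b) (sgn b))) (cong ι_ (sgn² b)))) (ℚ.*-identityˡ x))

  act-inverse : ∀ {ρ ρ′} {b b′ : Fin k → Bool} → (∀ i → ρ′ (ρ i) ≡ i) → (∀ i → b i ≡ b′ (ρ i)) → ∀ v → act ρ b (act ρ′ b′ v) ≡ v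
  act-inverse {ρ} {ρ′} {b} {b′} inv signs v = amb-ext (λ i x → begin
    lookup (lookup (act ρ b (act ρ′ b′ v)) i) x ≡⟨ lookup-act ρ b (act ρ′ b′ v) i x ⟩
    ι sgn (b i) ℚ.* lookup (lookup (act ρ′ b′ v) (ρ i)) x ≡⟨ cong₂ (λ c y → ι sgn c ℚ.* y) (signs i) (lookup-act ρ′ b′ v (ρ i) x) ⟩
    ι sgn (b′ (ρ i)) ℚ.* (ι sgn (b′ (ρ i)) ℚ.* lookup (lookup v (ρ′ (ρ i))) x) ≡⟨ ι-sgn² (b′ (ρ i)) _ ⟩
    lookup (lookup v (ρ′ (ρ i))) x ≡⟨ cong (λ j → lookup (lookup v j) x) (inv i) ⟩
    lookup (lookup v i) x ∎)
    where open ≡-Reasoning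

  act-add : ∀ ρ b u v → act ρ b (addAmb p u v) ≡ addAmb p (act ρ b u) (act ρ b v)
  act-add ρ b u v = amb-ext (λ i x → begin
    lookup (lookup (act ρ b (addAmb p u v)) i) x ≡⟨ lookup-act ρ b (addAmb p u v) i x ⟩
    ι sgn (b i) ℚ.* lookup (lookup (addAmb p u v) (ρ i)) x ≡⟨ cong (ι sgn (b i) ℚ.*_) (lookup-add u v (ρ i) x) ⟩
    ι sgn (b i) ℚ.* (lookup (lookup u (ρ i)) x ℚ.+ lookup (lookup v (ρ i)) x) ≡⟨ ℚ.*-distribˡ-+ (ι sgn (b i)) _ _ ⟩
    ι sgn (b i) ℚ.* lookup (lookup u (ρ i)) x ℚ.+ ι sgn (b i) ℚ.* lookup (lookup v (ρ i)) x
      ≡⟨ sym (cong₂ ℚ._+_ (lookup-act ρ b u i x) (lookup-act ρ b v i x)) ⟩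
    lookup (lookup (act ρ b u) i) x ℚ.+ lookup (lookup (act ρ b v) i) x ≡⟨ sym (lookup-add (act ρ b u) (act ρ b v) i x) ⟩
    lookup (lookup (addAmb p (act ρ b u) (act ρ b v)) i) x ∎)
    where
    open ≡-Reasoning
    lookup-add : ∀ u v i x → lookup (lookup (addAmb p u v) i) x ≡ lookup (lookup u i) x ℚ.+ lookup (lookup v i) x
    lookup-add u v i x = trans (cong (λ w → lookup w x) (lookup-zipWith (zipWith ℚ._+_) i u v)) (lookup-zipWith ℚ._+_ x (lookup u i) (lookup v i))

  act-inner : ∀ (π : Permutation′ k) b u v → inner p (act (π ⟨$⟩ʳ_) b u) (act (π ⟨$⟩ʳ_) b v) ≡ inner p u v
  act-inner π b u v = begin
    inner p (act ρ b u) (act ρ b v) ≡⟨ inner-sum (act ρ b u) (act ρ b v) ⟩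
    Σℚ.sum (λ i → Σℚ.sum (λ x → lookup (lookup (act ρ b u) i) x ℚ.* lookup (lookup (act ρ b v) i) x))
      ≡⟨ Σℚ.sum-cong-≗ (λ i → Σℚ.sum-cong-≗ (λ x → trans (cong₂ ℚ._*_ (lookup-act ρ b u i x) (lookup-act ρ b v i x))
           (trans (swap (ι sgn (b i)) (lookup (lookup u (ρ i)) x) (lookup (lookup v (ρ i)) x)) (ι-sgn² (b i) _)))) ⟩
    Σℚ.sum (λ i → blockwise (ρ i)) ≡⟨ sym (Σℚ.sum-permute blockwise π) ⟩
    Σℚ.sum blockwise ≡⟨ sym (inner-sum u v) ⟩
    inner p u v ∎
    where
    open ≡-Reasoning
    open +-*-Solver using (solve; _:=_; _:*_)
    ρ : Fin k → Fin k
    ρ = π ⟨$⟩ʳ_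
    blockwise : Fin k → ℚ
    blockwise i = Σℚ.sum (λ x → lookup (lookup u i) x ℚ.* lookup (lookup v i) x)
    swap : ∀ e a b → (e ℚ.* a) ℚ.* (e ℚ.* b) ≡ e ℚ.* (e ℚ.* (a ℚ.* b))
    swap = solve 3 (λ e a b → (e :* a) :* (e :* b) := e :* (e :* (a :* b))) refl

  actM : (Fin k → Fin k) → (Fin k → Bool) → M k → M k
  actM ρ b z i x = sgn (b i) * z (ρ i) x

  act-toAmb : ∀ ρ b z → act ρ b (toAmb z) ≡ toAmb (actM ρ b z)
  act-toAmb ρ b z = toAmb-ext (actM ρ b z) (λ i x → begin
    lookup (lookup (act ρ b (toAmb z)) i) x ≡⟨ lookup-act ρ b (toAmb z) i x ⟩
    ι sgn (b i) ℚ.* lookup (lookup (toAmb z) (ρ i)) x ≡⟨ cong (ι sgn (b i) ℚ.*_) (lookup-toAmb z (ρ i) x) ⟩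
    ι sgn (b i) ℚ.* (ι z (ρ i) x ℚ.- ι sum (z (ρ i)) ℚ.* c) ≡⟨ distribute (ι sgn (b i)) (ι z (ρ i) x) (ι sum (z (ρ i))) c ⟩
    ι sgn (b i) ℚ.* ι z (ρ i) x ℚ.- (ι sgn (b i) ℚ.* ι sum (z (ρ i))) ℚ.* c
      ≡⟨ cong₂ (λ a S → a ℚ.- S ℚ.* c) (sym (ι-* (sgn (b i)) (z (ρ i) x)))
           (trans (sym (ι-* (sgn (b i)) (sum (z (ρ i))))) (cong ι_ (sym (sum-scale (sgn (b i)) (z (ρ i)))))) ⟩
    ι (actM ρ b z i x) ℚ.- ι (sum (actM ρ b z i)) ℚ.* c ∎)
    where
    open ≡-Reasoning
    open +-*-Solver using (solve; _:=_; _:*_; _:-_)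
    distribute : ∀ e z S c → e ℚ.* (z ℚ.- S ℚ.* c) ≡ e ℚ.* z ℚ.- (e ℚ.* S) ℚ.* c
    distribute = solve 4 (λ e z S c → e :* (z :- S :* c) := e :* z :- (e :* S) :* c) refl

  LA-act : ∀ {C D : Vec (Fin p) k → Set} ρ b → (∀ z → Mem C z → Mem D (actM ρ b z)) → ∀ v → LA p C v → LA p D (act ρ b v)
  LA-act {C} {D} ρ b h v m = from (LA⇒Mem {C = C} {v} m)
    where
    from : (∃ λ z → Mem C z × v ≡ toAmb z) → LA p D (act ρ b v)
    from (z , mz , refl) = subst (LA p D) (sym (act-toAmb ρ b z)) (Mem⇒LA {C = D} {actM ρ b z} (h z mz))

  signed-word : ∀ (π : Permutation′ k) s x i → ⟦ lookup (signedPerm p π s x) i ⟧ ∼ sgn (lookup s i) * ⟦ lookup x (π ⟨$⟩ʳ i) ⟧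
  signed-word π s x i = ∼-trans (∼-reflexive (cong ⟦_⟧ (lookup∘tabulate
    (λ i → if lookup s i then -F_ p (lookup x (π ⟨$⟩ʳ i)) else lookup x (π ⟨$⟩ʳ i)) i))) (signed (lookup s i))
    where
    signed : ∀ b → ⟦ if b then -F_ p (lookup x (π ⟨$⟩ʳ i)) else lookup x (π ⟨$⟩ʳ i) ⟧ ∼ sgn b * ⟦ lookup x (π ⟨$⟩ʳ i) ⟧
    signed true = ∼-trans (⟦-⟧ (lookup x (π ⟨$⟩ʳ i))) (∼-reflexive (sym (-1*i≡-i _)))
    signed false = ∼-reflexive (sym (*-identityˡ _))

  codeIso⇒latticeIso : ∀ {C D : Vec (Fin p) k → Set} → CodeIso p C D → LatticeIso p (LA p C) (LA p D)
  codeIso⇒latticeIso {C} {D} (π , s , hC , hD) =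
    act ρ b , act ρ′ b′ , LA-act {C} {D} ρ b forward , LA-act {D} {C} ρ′ b′ backward ,
    (λ v _ → act-inverse {b = b′} {b} (λ i → inverseʳ π) (λ i → refl) v) ,
    (λ v _ → act-inverse {b = b} {b′} (λ i → inverseˡ π) (λ i → cong b (sym (inverseˡ π))) v) ,
    (λ u v _ _ → act-add ρ b u v) , (λ u v _ _ → act-inner π b u v)
    where
    ρ ρ′ : Fin k → Fin k
    ρ = π ⟨$⟩ʳ_
    ρ′ = π ⟨$⟩ˡ_
    b b′ : Fin k → Bool
    b = lookup s
    -- The inverse brings the entry at `ρ′ i` to position i, so it has to undo the sign attached to
    -- `ρ′ i`.
    b′ i = b (ρ′ i)
    forward : ∀ z → Mem C z → Mem D (actM ρ b z)
    forward z (a , Ca , za) = signedPerm p π s a , hC a Ca , λ i →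
      ∼-trans (∼-reflexive (sum-scale (sgn (b i)) (z (ρ i)))) (∼-trans (∼-* (∼-reflexive {sgn (b i)} refl) (za (ρ i))) (∼-sym (signed-word π s a i)))
    backward : ∀ z → Mem D z → Mem C (actM ρ′ b′ z)
    backward z (y , Dy , zy) = from (hD y Dy)
      where
      from : (Σ (Vec (Fin p) k) λ x → C x × signedPerm p π s x ≡ y) → Mem C (actM ρ′ b′ z)
      from (x , Cx , refl) = x , Cx , λ i →
        ∼-trans (∼-reflexive (sum-scale (sgn (b′ i)) (z (ρ′ i))))
          (∼-trans (∼-* (∼-reflexive {sgn (b′ i)} refl) (∼-trans (zy (ρ′ i)) (signed-word π s x (ρ′ i))))
            (∼-reflexive (trans (sym (*-assoc (sgn (b′ i)) (sgn (b′ i)) _)) (trans (cong (_* ⟦ lookup x (ρ (ρ′ i)) ⟧) (sgn² (b′ i)))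
              (trans (*-identityˡ _) (cong (λ j → ⟦ lookup x j ⟧) (inverseʳ π)))))))

theorem3p1 : (p : ℕ) {{_ : NonZero p}} → Prime p → ¬ (2 ∣ p) →
    (k : ℕ) (C D : Vec (Fin p) k → Set) →
    IsSubspace p C → IsSubspace p D →
    SelfOrthogonal p C → SelfOrthogonal p D →
    (LatticeIso p (LA p C) (LA p D) ⇔ CodeIso p C D)
theorem3p1 zero pr = contradiction pr ¬prime[0]
theorem3p1 (suc q) pr odd k C D isC isD soC soD = mk⇔ latticeIso⇒codeIso (SignedPermutation.codeIso⇒latticeIso q)
  where
  open Isometries q isC isD soD using (Isometry; Processed)
  1≤q : 1 ℕ.≤ q
  1≤q = ℕ.s≤s⁻¹ (ℕ.nonTrivial⇒n>1 (suc q) {{prime⇒nonTrivial pr}})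
  aligned : (Σ Isometry λ φ → Processed φ k) → CodeIso (suc q) C D
  aligned (φ , stars) = Extraction.code-iso q isC isD soD 1≤q φ (λ i → stars i (Fin.toℕ<n i))
  latticeIso⇒codeIso : LatticeIso (suc q) (LA (suc q) C) (LA (suc q) D) → CodeIso (suc q) C D
  latticeIso⇒codeIso iso = aligned (Alignment.align q isC isD soD pr odd (Model.lattice-isometry q isC isD soD iso) k ℕ.≤-refl)
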